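{- Let $n\ge 1$. For every partition $\pi=\{B_1,B_2,\ldots,B_k\}$ of $[n]$ (blocks listed in increasing order of their minimal elements) that is atomic and splitable, define $\varphi(\pi)$ as follows: (1) let $i$ be the smallest element of $B_1$ with $i\ge 2$ such that $\pi=\pi_{[i-1]}\circ(\pi_{[i,n]}-i+1)$ (such an $i$ exists because $\pi$ is splitable); (2) let $j$ be the smallest element of the underlying set of the partition $R(\pi_{[i,n]})$; (3) set $\varphi(\pi)=\pi_{[j-1]}\,\big|\,(\pi_{[j,n]}-j+1)$. Then $\varphi$ is a bijection from the set $\mathcal{A}_n\setminus\mathcal{US}_n$ of atomic, splitable partitions of $[n]$ onto the set $\mathcal{US}_n\setminus\mathcal{A}_n$ of unsplitable, non-atomic partitions of $[n]$.
   Context: $[n]=\{1,\ldots,n\}$ and $[a,b]=\{a,a+1,\ldots,b\}$. A partition of a totally ordered finite set $X$ is a family of disjoint nonempty subsets (blocks) with union $X$; blocks are listed in increasing order of their minimal elements. For $S\subseteq X$, the restriction $\pi_S$ is the partition of $S$ obtained from $\pi$ by deleting all elements not in $S$ (two elements of $S$ are in the same block of $\pi_S$ iff they are in the same block of $\pi$). For a partition $\tau$ of a set of integers and an integer $c$, $\tau-c$ (resp. $\tau+c$) denotes the partition obtained by subtracting (resp. adding) $c$ to every element of every block; thus $\pi_{[i,n]}-i+1$ is a partition of $[n-i+1]$. For $\pi=\{B_1,\ldots,B_k\}$ a partition of $[m]$ and $\sigma=\{C_1,\ldots,C_l\}$ a partition of $[n']$ (blocks in standard order), the slash product is $\pi|\sigma=\{B_1,\ldots,B_k,C_1+m,\ldots,C_l+m\}$,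 a partition of $[m+n']$. A partition is atomic if it is not of the form $\sigma|\tau$ with $\sigma,\tau$ nonempty partitions. The split product is $\pi\circ\sigma=\{B_1\cup(C_1+m),\ldots,B_k\cup(C_k+m),C_{k+1}+m,\ldots,C_l+m\}$ if $k\le l$, and $\{B_1\cup(C_1+m),\ldots,B_l\cup(C_l+m),B_{l+1},\ldots,B_k\}$ if $k>l$. A partition is splitable if it equals $\sigma\circ\tau$ for nonempty partitions $\sigma,\tau$, and unsplitable otherwise. $\mathcal{A}_n$ denotes the set of atomic partitions of $[n]$ and $\mathcal{US}_n$ the set of unsplitable partitions of $[n]$. For a partition $\pi=\{B_1,\ldots,B_k\}$ of $X=\{x_1<x_2<\cdots<x_N\}$, let $r$ be the largest index such that $B_r\cup B_{r+1}\cup\cdots\cup B_k=\{x_t,x_{t+1},\ldots,x_N\}$ for some $t$; then $R(\pi)=\{B_r,B_{r+1},\ldots,B_k\}$. -}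

module Defs where

open import Data.List.Base using (List; []; _∷_; _++_; map; filter; concat; drop; length)
open import Data.List.Membership.Propositional using (_∈_)
open import Data.List.Relation.Binary.Disjoint.Propositional using (Disjoint)
open import Data.List.Relation.Unary.All using (All)
open import Data.List.Relation.Unary.AllPairs using (AllPairs)
open import Data.Nat.Base using (ℕ; _+_; _∸_; _≤_; _<_)
open import Data.Nat.Properties using (_≤?_; ≤-decTotalOrder)
open import Data.Product using (Σ; ∃; ∃₂; _×_; proj₁)
open import Function.Base using (_on_)
open import Function.Bundles using (_⇔_)
open import Level using (0ℓ)
open import Relation.Binary.Bundles using (DecTotalOrder)
open import Relation.Binary.Core using (Rel)
open import Relation.Binary.PropositionalEquality using (_≡_; _≢_; refl)
open import Relation.Nullary using (¬_; yes; no; _×-dec_)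
open import Relation.Unary using (Pred; Decidable)
import Data.List.Sort.InsertionSort
import Relation.Binary.Construct.On as On

-- A block is the increasing list of its elements and a partition is the list
-- of its blocks in increasing order of minima.  Every partition has exactly one
-- such listing, so equality of partitions is _≡_ of lists.

Block : Set
Block = List ℕ

Blocks : Set
Blocks = List Block

-- The value on [] is irrelevant: blocks are nonempty.
minElt : Block → ℕ
minElt []      = 0
minElt (x ∷ _) = x

[_⋯_] : ℕ → ℕ → Pred ℕ 0ℓ
[ a ⋯ b ] x = a ≤ x × x ≤ b

record IsPartition (X : Pred ℕ 0ℓ) (π : Blocks) : Set where
  field
    nonEmpty   : All (_≢ []) π
    increasing : All (AllPairs _<_) π
    ordered    : AllPairs (_<_ on minElt) π
    disjoint   : AllPairs Disjoint π
    covers     : ∀ x → x ∈ concat π ⇔ X x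

PartitionOf[_] : ℕ → Pred Blocks 0ℓ
PartitionOf[ n ] = IsPartition [ 1 ⋯ n ]

_⊞_ : Blocks → ℕ → Blocks
π ⊞ c = map (map (_+ c)) π

-- Only used when every element of π exceeds c, so there is no truncation.
_⊟_ : Blocks → ℕ → Blocks
π ⊟ c = map (map (_∸ c)) π

minOrder : DecTotalOrder 0ℓ 0ℓ 0ℓ
minOrder = On.decTotalOrder ≤-decTotalOrder minElt

open Data.List.Sort.InsertionSort minOrder using () renaming (sort to sortByMin)

nonEmpty? : Decidable {A = Block} (_≢ [])
nonEmpty? []      = no λ ne → ne refl
nonEmpty? (_ ∷ _) = yes λ ()

-- π restricted to [a,b].  Deleting elements can change the relative order of
-- the minima, hence the sorting.
restrict : ℕ → ℕ → Blocks → Blocks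
restrict a b π =
  sortByMin (filter nonEmpty? (map (filter (λ x → (a ≤? x) ×-dec (x ≤? b))) π))

-- In both products m is the size of the left factor, a partition of [m].

slash : ℕ → Blocks → Blocks → Blocks
slash m π σ = π ++ (σ ⊞ m)

unionBlocks : Blocks → Blocks → Blocks
unionBlocks []       Cs       = Cs
unionBlocks (B ∷ Bs) []       = B ∷ Bs
unionBlocks (B ∷ Bs) (C ∷ Cs) = (B ++ C) ∷ unionBlocks Bs Cs

split : ℕ → Blocks → Blocks → Blocks
split m π σ = unionBlocks π (σ ⊞ m)

IsProduct : (ℕ → Blocks → Blocks → Blocks) → Pred Blocks 0ℓ
IsProduct _·⟨_⟩_ π =
  ∃₂ λ m n → ∃₂ λ σ τ →
    1 ≤ m × 1 ≤ n × PartitionOf[ m ] σ × PartitionOf[ n ] τ × π ≡ _·⟨_⟩_ m σ τ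

Atomic : Pred Blocks 0ℓ
Atomic π = ¬ IsProduct slash π

Splitable : Pred Blocks 0ℓ
Splitable = IsProduct split

Unsplitable : Pred Blocks 0ℓ
Unsplitable π = ¬ Splitable π

𝒜 : ℕ → Pred Blocks 0ℓ
𝒜 n π = PartitionOf[ n ] π × Atomic π

𝒰𝒮 : ℕ → Pred Blocks 0ℓ
𝒰𝒮 n π = PartitionOf[ n ] π × Unsplitable π

IsLeast : Pred ℕ 0ℓ → Pred ℕ 0ℓ
IsLeast P i = P i × (∀ k → P k → i ≤ k)

IsGreatest : Pred ℕ 0ℓ → Pred ℕ 0ℓ
IsGreatest P i = P i × (∀ k → P k → k ≤ i)

-- drop r π is {B_{r+1},…,B_k}; its union is {x_t,…,x_N}, where t here stands
-- for the element x_t rather than for its index.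
IsUpperFrom : Blocks → Pred ℕ 0ℓ
IsUpperFrom π r =
  r < length π ×
  ∃ λ t → t ∈ concat π × (∀ x → x ∈ concat (drop r π) ⇔ (x ∈ concat π × t ≤ x))

-- ρ = R(π)
IsR : Blocks → Blocks → Set
IsR π ρ = ∃ λ r → IsGreatest (IsUpperFrom π) r × ρ ≡ drop r π

firstBlock : Blocks → Block
firstBlock []      = []
firstBlock (B ∷ _) = B

SplitsAt : ℕ → Blocks → Pred ℕ 0ℓ
SplitsAt n π i =
  i ∈ firstBlock π × 2 ≤ i ×
  π ≡ split (i ∸ 1) (restrict 1 (i ∸ 1) π) (restrict i n π ⊟ (i ∸ 1))

-- The graph of φ.  Each of i, ρ, j and π′ is determined by what precedes it, so
-- this relates π to at most one π′.
record Isφ (n : ℕ) (π π′ : Blocks) : Set where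
  field
    i       : ℕ
    i-least : IsLeast (SplitsAt n π) i
    ρ       : Blocks
    ρ-isR   : IsR (restrict i n π) ρ
    j       : ℕ
    j-least : IsLeast (_∈ concat ρ) j
    value   : π′ ≡ slash (j ∸ 1) (restrict 1 (j ∸ 1) π) (restrict j n π ⊟ (j ∸ 1))

-- A subset of partitions as a type; its elements are compared by _≈_, which
-- ignores the membership proofs.
⟦_⟧ : Pred Blocks 0ℓ → Set
⟦ P ⟧ = Σ Blocks P

_≈_ : {P : Pred Blocks 0ℓ} → Rel ⟦ P ⟧ 0ℓ
_≈_ = _≡_ on proj₁

{-# OPTIONS --safe #-}
module Submission where

-- Record a partition by its restricted growth word, whose p-th letter is the
-- index of the block of p.  The split product becomes concatenation, u·v, and
-- the slash product u|v concatenation after raising the letters of v by the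
-- number of blocks of u.  Every word is uniquely u·v with u unsplitable and v
-- of restricted growth, and uniquely v₁|v₂ with v₂ atomic.  Cutting off first
-- u and then v₂, the atomic splitable words are exactly the u·(v₁|v₂), and the
-- unsplitable non-atomic ones exactly the (u·v₁)|v₂, in both cases with u
-- unsplitable, v₂ atomic and v₁ (possibly empty) having fewer blocks than u.
-- The map φ sends u·(v₁|v₂) to (u·v₁)|v₂.

open import Defs
open import Data.Empty using (⊥; ⊥-elim)
open import Data.List.Base using (List; []; _∷_; _++_; map; filter; concat; take; drop; length; applyUpTo)
open import Data.List.Properties
open import Data.List.Membership.Propositional using (_∈_; _∉_)
open import Data.List.Membership.Propositional.Properties
open import Data.List.Relation.Unary.All as All using (All; []; _∷_)
import Data.List.Relation.Unary.All.Properties as All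
open import Data.List.Relation.Unary.AllPairs as AllPairs using (AllPairs; []; _∷_)
import Data.List.Relation.Unary.AllPairs.Properties as AllPairs
open import Data.List.Relation.Unary.Linked.Properties using (Linked⇒AllPairs)
open import Data.List.Relation.Binary.Permutation.Propositional using (↭-sym)
open import Data.List.Relation.Binary.Permutation.Propositional.Properties using (All-resp-↭)
open import Data.List.Sort.InsertionSort minOrder using (sort)
open import Data.List.Sort.InsertionSort.Properties minOrder using (sort-↭; sort-↗)
open import Data.List.Relation.Unary.Any using (here; there)
open import Data.Nat.Base using (ℕ; zero; suc; _+_; _∸_; _⊔_; _≤_; _<_; z≤n; s≤s)
open import Data.Nat.Properties
open import Data.Product using (Σ; ∃; ∃₂; _×_; _,_; proj₁; proj₂; map₁; map₂)
open import Data.Sum using (_⊎_; inj₁; inj₂)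
open import Function.Base using (_∘_; _on_)
open import Function.Bundles using (_⇔_; mk⇔; Equivalence)
open import Function.Definitions using (Bijective)
open import Relation.Binary.Definitions using (tri<; tri≈; tri>)
open import Relation.Binary.PropositionalEquality
open import Relation.Nullary using (¬_; Dec; yes; no; _×-dec_; contradiction)
open import Relation.Nullary.Decidable using (map′; dec-true)
open import Relation.Unary using (_∖_)

-- The inequality comes from the shift. In the source, `v₂` is raised by the block count `a` of
-- `v₁`; in the target, by the block count of `u·v₁`, which is the larger of `a` and the block count
-- `h` of `u`. If `a ≥ h`, the two words coincide and the partition is both splitable and a slash
-- product; `a < h` is what keeps the two kinds apart.
--
-- The definition of φ mentions no factorisation; three facts tie it to the words. An unsplitable
-- left factor is the shortest one, so the least `i` is the first position after `u`. Unions of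
-- final blocks of `v₁|v₂` that are upper sets correspond to slash cuts, the number of omitted
-- blocks being the number of labels before the cut, so the greatest index is `a` and `R` consists
-- of the blocks of `v₂`. Finally, restriction sorts blocks by their minima, so the equation
-- defining `i` speaks of sorted blocks only; compared block by block, it makes the suffix a
-- restricted growth word.
--
-- No inverse of φ is computed: either word determines `u`, `v₁` and `v₂`, which gives injectivity
-- and surjectivity.

variable
  k k′ l l′ m : ℕ
  w x y z : List ℕ

-- RG k w l: read after a word with labels 0,…,k-1, the word w is of restricted
-- growth, and afterwards the labels 0,…,l-1 have been used.
data RG : ℕ → List ℕ → ℕ → Set where
  []  : RG k [] k
  old : ∀ {c} → c < k → RG k w l → RG k (c ∷ w) l
  new : ∀ {c} → c ≡ k → RG (suc k) w l → RG k (c ∷ w) l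

RGF : List ℕ → Set
RGF w = ∃ (RG 0 w)

RG-from : k ≡ k′ → RG k w l → RG k′ w l
RG-from refl r = r

RG-mono : RG k w l → k ≤ l
RG-mono []        = ≤-refl
RG-mono (old _ r) = RG-mono r
RG-mono (new _ r) = <⇒≤ (RG-mono r)

RG-functional : RG k w l → RG k w l′ → l ≡ l′
RG-functional []           []           = refl
RG-functional (old _ r)    (old _ s)    = RG-functional r s
RG-functional (old c<k _)  (new c≡k _)  = contradiction c≡k (<⇒≢ c<k)
RG-functional (new c≡k _)  (old c<k _)  = contradiction c≡k (<⇒≢ c<k)
RG-functional (new _ r)    (new _ s)    = RG-functional r s

RG-++⁺ : RG k x l → RG l y m → RG k (x ++ y) m
RG-++⁺ []        s = s
RG-++⁺ (old p r) s = old p (RG-++⁺ r s)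
RG-++⁺ (new p r) s = new p (RG-++⁺ r s)

RG-++⁻ : ∀ x → RG k (x ++ y) m → ∃ λ l → RG k x l × RG l y m
RG-++⁻ []      r         = _ , [] , r
RG-++⁻ (_ ∷ x) (old p r) = map₂ (map₁ (old p)) (RG-++⁻ x r)
RG-++⁻ (_ ∷ x) (new p r) = map₂ (map₁ (new p)) (RG-++⁻ x r)

RG-shift⁺ : ∀ a → RG k w l → RG (a + k) (map (a +_) w) (a + l)
RG-shift⁺ a []                 = []
RG-shift⁺ a (old c<k r)        = old (+-monoʳ-< a c<k) (RG-shift⁺ a r)
RG-shift⁺ {k} a (new refl r)   = new refl (RG-from (+-suc a k) (RG-shift⁺ a r))

RG-shift⁰ : ∀ a → RG 0 w l → RG a (map (a +_) w) (a + l)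
RG-shift⁰ a r = RG-from (+-identityʳ a) (RG-shift⁺ a r)

-- Labels are reused, not raised: a letter that opened a block below `k` becomes old, and only
-- letters from `k` on still open one. Hence the maximum, which is the block count of a split
-- product.
RG-lift : RG k′ w l → k′ ≤ k → RG k w (k ⊔ l)
RG-lift {k = k} [] k′≤k = subst (RG k []) (sym (m≥n⇒m⊔n≡m k′≤k)) []
RG-lift (old c<k′ r) k′≤k = old (<-≤-trans c<k′ k′≤k) (RG-lift r k′≤k)
RG-lift {l = l} {k = k} (new refl r) k′≤k with m≤n⇒m<n∨m≡n k′≤k
... | inj₁ k′<k  = old k′<k (RG-lift r k′<k)
... | inj₂ refl = new refl (subst (RG (suc k) _)
  (trans (m≤n⇒m⊔n≡n (RG-mono r)) (sym (m≤n⇒m⊔n≡n (<⇒≤ (RG-mono r))))) (RG-lift r ≤-refl))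

RG-lift⁰ : RG 0 w l → RG k w (k ⊔ l)
RG-lift⁰ r = RG-lift r z≤n

RG-concat : RG 0 x k → RG 0 y l → RG 0 (x ++ y) (k ⊔ l)
RG-concat r s = RG-++⁺ r (RG-lift⁰ s)

RG-slash : RG 0 x k → RG 0 y l → RG 0 (x ++ map (k +_) y) (k + l)
RG-slash {k = k} r s = RG-++⁺ r (RG-shift⁰ k s)

RG-all< : RG k w l → All (_< l) w
RG-all< []           = []
RG-all< (old c<k r)  = <-≤-trans c<k (RG-mono r) ∷ RG-all< r
RG-all< (new refl r) = RG-mono r ∷ RG-all< r

RG-surjective : ∀ {c} → RG k w l → k ≤ c → c < l → c ∈ w
RG-surjective [] k≤c c<k = contradiction c<k (≤⇒≯ k≤c)
RG-surjective (old _ r) k≤c c<l = there (RG-surjective r k≤c c<l)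
RG-surjective (new refl r) k≤c c<l with m≤n⇒m<n∨m≡n k≤c
... | inj₁ k<c  = there (RG-surjective r k<c c<l)
... | inj₂ refl = here refl

-- Applied at cuts: a nonempty remainder whose letters are all at least `c` forces at least `c`
-- labels to have been used before it. For `k = 0` the first letter must be 0.
RG-head : ∀ {d} → RG k (d ∷ w) l → d ≤ k
RG-head (old d<k _)  = <⇒≤ d<k
RG-head (new refl _) = ≤-refl

RG-nonEmpty : RG 0 w l → w ≢ [] → 1 ≤ l
RG-nonEmpty []           w≢[] = contradiction refl w≢[]
RG-nonEmpty (new _ r)    _    = RG-mono r

RG-unshift : ∀ a → RG (a + k) w l → All (a ≤_) w →
             ∃₂ λ y m → w ≡ map (a +_) y × RG k y m × l ≡ a + m
RG-unshift a [] [] = [] , _ , refl , [] , refl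
RG-unshift a (old c<a+k r) (a≤c ∷ a≤w) with RG-unshift a r a≤w | m≤n⇒∃[o]m+o≡n a≤c
... | y , m , refl , s , refl | d , refl =
  d ∷ y , m , refl , old (+-cancelˡ-< a _ _ c<a+k) s , refl
RG-unshift {k = k} a (new refl r) (_ ∷ a≤w)
  with RG-unshift a (RG-from (sym (+-suc a k)) r) a≤w
... | y , m , refl , s , refl = k ∷ y , m , refl , new refl s , refl

RG-unshift⁰ : ∀ a → RG a w l → All (a ≤_) w →
              ∃₂ λ y m → w ≡ map (a +_) y × RG 0 y m × l ≡ a + m
RG-unshift⁰ a r = RG-unshift a (RG-from (sym (+-identityʳ a)) r)

RG? : ∀ k w → Dec (∃ (RG k w))
RG? k [] = yes (k , [])
RG? k (c ∷ w) with <-cmp c k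
... | tri< c<k c≢k _ = map′ (map₂ (old c<k))
  (λ { (l , old _ r) → l , r ; (l , new c≡k _) → contradiction c≡k c≢k }) (RG? k w)
... | tri≈ c≮k c≡k _ = map′ (map₂ (new c≡k))
  (λ { (l , old c<k _) → contradiction c<k c≮k ; (l , new _ r) → l , r }) (RG? (suc k) w)
... | tri> c≮k c≢k _ = no
  λ { (l , old c<k _) → c≮k c<k ; (l , new c≡k _) → c≢k c≡k }

≥-shift : ∀ a w → All (a ≤_) (map (a +_) w)
≥-shift a w = All.map⁺ (All.universal (m≤m+n a) w)

++≢[]ˡ : x ≢ [] → x ++ y ≢ []
++≢[]ˡ {x = x} x≢[] eq = x≢[] (++-conicalˡ x _ eq)

++≢[]ʳ : ∀ x → y ≢ [] → x ++ y ≢ []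
++≢[]ʳ x y≢[] eq = y≢[] (++-conicalʳ x _ eq)

map≢[] : ∀ {f : ℕ → ℕ} → x ≢ [] → map f x ≢ []
map≢[] {x = []}    x≢[] = contradiction refl x≢[]
map≢[] {x = _ ∷ _} _    = λ ()

length-pos : x ≢ [] → 1 ≤ length x
length-pos {x = []}    x≢[] = contradiction refl x≢[]
length-pos {x = _ ∷ _} _    = s≤s z≤n

++-levi : ∀ x {y} u {v : List ℕ} → x ++ y ≡ u ++ v →
          (∃ λ t → u ≡ x ++ t × y ≡ t ++ v) ⊎
          (∃ λ t → t ≢ [] × x ≡ u ++ t × v ≡ t ++ y)
++-levi []      u       eq = inj₁ (u , refl , eq)
++-levi (a ∷ x) []      eq = inj₂ (a ∷ x , (λ ()) , refl , sym eq)
++-levi (a ∷ x) (b ∷ u) eq with ∷-injective eq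
... | refl , eq′ with ++-levi x u eq′
... | inj₁ (t , p , q)       = inj₁ (t , cong (a ∷_) p , q)
... | inj₂ (t , t≢[] , p , q) = inj₂ (t , t≢[] , cong (a ∷_) p , q)

-- Factorisations of words

-- Nothing but nonemptiness is asked of `x`, since a prefix of a restricted growth word is again
-- one.
Splits : List ℕ → Set
Splits w = ∃₂ λ x y → w ≡ x ++ y × x ≢ [] × y ≢ [] × RGF y

-- The right factor stays raised. After a prefix with `c` labels, letters that are all at least `c`
-- are those of a raised restricted growth word, provided the whole word is of restricted growth;
-- see `slashes⁻`.
Slashes : List ℕ → Set
Slashes w = ∃₂ λ x z → w ≡ x ++ z × x ≢ [] × z ≢ [] × ∃ λ c → RG 0 x c × All (c ≤_) z

slashes⁺ : ∀ {c} → RG 0 x c → x ≢ [] → y ≢ [] → Slashes (x ++ map (c +_) y)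
slashes⁺ {x = x} {y = y} {c = c} r x≢[] y≢[] = x , _ , refl , x≢[] , map≢[] y≢[] , c , r , ≥-shift c y

slashes⁻ : RG 0 w l → Slashes w → ∃₂ λ x y → ∃₂ λ c d →
           w ≡ x ++ map (c +_) y × x ≢ [] × y ≢ [] × RG 0 x c × RG 0 y d × l ≡ c + d
slashes⁻ r (x , z , refl , x≢[] , z≢[] , c , rx , c≤z) with RG-++⁻ x r
... | c′ , rx′ , rz with RG-functional rx rx′
... | refl with RG-unshift⁰ c rz c≤z
... | y , d , refl , ry , eq =
  x , y , c , d , refl , x≢[] , (λ { refl → z≢[] refl }) , rx , ry , eq

∃++? : {P : List ℕ → List ℕ → Set} → (∀ x y → Dec (P x y)) →
       ∀ w → Dec (∃₂ λ x y → w ≡ x ++ y × P x y)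
∃++? P? [] with P? [] []
... | yes p = yes ([] , [] , refl , p)
... | no ¬p = no λ { ([] , [] , refl , p) → ¬p p }
∃++? P? (a ∷ w) with P? [] (a ∷ w) | ∃++? (λ x → P? (a ∷ x)) w
... | yes p | _ = yes ([] , a ∷ w , refl , p)
... | no _  | yes (x , y , refl , p) = yes (a ∷ x , y , refl , p)
... | no ¬p | no ¬q = no λ
  { ([] , _ , refl , p) → ¬p p ; (_ ∷ x , y , refl , p) → ¬q (x , y , refl , p) }

splits? : ∀ w → Dec (Splits w)
splits? = ∃++? λ x y → nonEmpty? x ×-dec nonEmpty? y ×-dec RG? 0 y

slashes? : ∀ w → Dec (Slashes w)
slashes? = ∃++? λ x z → nonEmpty? x ×-dec nonEmpty? z ×-dec cut? x z
  where
  cut? : ∀ x z → Dec (∃ λ c → RG 0 x c × All (c ≤_) z)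
  cut? x z with RG? 0 x
  ... | no ¬r = no λ { (c , r , _) → ¬r (c , r) }
  ... | yes (c , r) = map′ (λ p → c , r , p)
    (λ { (c′ , r′ , p) → subst (λ c → All (c ≤_) z) (RG-functional r′ r) p })
    (All.all? (c ≤?_) z)

-- No slash factorisation of v₁ | v₂ can cut inside the atomic factor v₂.
atomic-last : ∀ {a c} v₁ {v₂ z s} → RG 0 v₁ a → ¬ Slashes v₂ →
              z ++ s ≡ v₁ ++ map (a +_) v₂ → s ≢ [] → RG 0 z c → All (c ≤_) s →
              ∃ λ t → v₁ ≡ z ++ t
atomic-last {a} {c} v₁ {v₂} {z} {s} r atom eq s≢[] rz c≤s with ++-levi z v₁ eq
... | inj₁ (t , p , _) = t , p
... | inj₂ (t , t≢[] , refl , q) with RG-++⁻ v₁ rz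
... | a′ , r′ , rt with RG-functional r r′
... | refl with RG-unshift⁰ a rt (All.++⁻ˡ t (subst (All (a ≤_)) q (≥-shift a v₂)))
... | t′ , c′ , refl , rt′ , refl with map-++-inverse v₂ t′ q
  where
  map-++-inverse : ∀ v t {s} → map (a +_) v ≡ map (a +_) t ++ s → ∃ λ s′ → v ≡ t ++ s′ × s ≡ map (a +_) s′
  map-++-inverse v []      refl = v , refl , refl
  map-++-inverse (d ∷ v) (e ∷ t) eq with ∷-injective eq
  ... | p , q with +-cancelˡ-≡ a d e p | map-++-inverse v t q
  ... | refl | s′ , refl , p′ = s′ , refl , p′
... | s′ , refl , refl = contradiction
  (t′ , s′ , refl , (λ { refl → t≢[] refl }) , (λ { refl → s≢[] refl }) , c′ , rt′ ,
   All.map (+-cancelˡ-≤ a _ _) (All.map⁻ c≤s))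
  atom

-- If `u′` ended strictly inside `u`, the rest of `u` would be a prefix of `v′`, hence of restricted
-- growth, and would split `u`.
unsplit-first : ∀ u {v u′ v′} → ¬ Splits u → u′ ≢ [] → RGF v′ →
                u ++ v ≡ u′ ++ v′ → ∃ λ t → u′ ≡ u ++ t × v ≡ t ++ v′
unsplit-first u {u′ = u′} unsp u′≢[] (_ , r) eq with ++-levi u u′ eq
... | inj₁ p = p
... | inj₂ (t , t≢[] , refl , refl) =
  contradiction (u′ , t , refl , u′≢[] , t≢[] , map₂ proj₁ (RG-++⁻ t r)) unsp

-- Only the left factor is split again. The right factors cut off are collected, and their
-- concatenation is of restricted growth. The bound `n` on the length makes the descent structural.
firstUnsplit : ∀ w → w ≢ [] → ∃₂ λ u v → w ≡ u ++ v × u ≢ [] × ¬ Splits u × RGF v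
firstUnsplit w = go (length w) w ≤-refl
  where
  go : ∀ n w → length w ≤ n → w ≢ [] → ∃₂ λ u v → w ≡ u ++ v × u ≢ [] × ¬ Splits u × RGF v
  go zero    []      _   w≢[] = contradiction refl w≢[]
  go (suc n) w       w≤n w≢[] with splits? w
  ... | no unsp = w , [] , sym (++-identityʳ w) , w≢[] , unsp , 0 , []
  ... | yes (x , y , refl , x≢[] , y≢[] , _ , ry)
    with go n x (≤-pred (≤-trans (subst (length x <_) (sym (length-++ x))
                  (m<m+n (length x) (length-pos y≢[]))) w≤n)) x≢[]
  ... | u , v , refl , u≢[] , unsp , _ , rv =
    u , v ++ y , ++-assoc u v y , u≢[] , unsp , _ , RG-concat rv ry

map-+-∘ : ∀ a c w → map (a +_) (map (c +_) w) ≡ map (a + c +_) w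
map-+-∘ a c w = trans (sym (map-∘ w)) (map-cong (λ d → sym (+-assoc a c d)) w)

slash-assoc : ∀ x {c} y {d} z →
  x ++ map (c +_) (y ++ map (d +_) z) ≡ (x ++ map (c +_) y) ++ map (c + d +_) z
slash-assoc x {c} y {d} z = begin
  x ++ map (c +_) (y ++ map (d +_) z)             ≡⟨ cong (x ++_) (map-++ (c +_) y _) ⟩
  x ++ map (c +_) y ++ map (c +_) (map (d +_) z)  ≡⟨ cong (λ s → x ++ map (c +_) y ++ s) (map-+-∘ c d z) ⟩
  x ++ map (c +_) y ++ map (c + d +_) z           ≡⟨ ++-assoc x _ _ ⟨
  (x ++ map (c +_) y) ++ map (c + d +_) z         ∎
  where open ≡-Reasoning

-- Mirror image of `firstUnsplit`: the right factor is cut again, and the left factors are collected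
-- by associativity of the slash product. The left factor may be empty, with shift 0.
lastAtomic : ∀ w → RG 0 w l → w ≢ [] → ∃₂ λ x y → ∃₂ λ c d →
             w ≡ x ++ map (c +_) y × RG 0 x c × RG 0 y d × y ≢ [] × ¬ Slashes y
lastAtomic w = go (length w) w ≤-refl
  where
  go : ∀ n w → length w ≤ n → RG 0 w l → w ≢ [] → ∃₂ λ x y → ∃₂ λ c d →
       w ≡ x ++ map (c +_) y × RG 0 x c × RG 0 y d × y ≢ [] × ¬ Slashes y
  go zero    []      _   _ w≢[] = contradiction refl w≢[]
  go {l} (suc n) w w≤n r w≢[] with slashes? w
  ... | no atom = [] , w , 0 , l , sym (map-id w) , [] , r , w≢[] , atom
  ... | yes sl with slashes⁻ r sl
  ... | x , y , c , d , refl , x≢[] , y≢[] , rx , ry , _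
    with go n y (≤-pred (≤-trans (subst₂ _<_ (length-map (c +_) y) (sym (length-++ x))
                  (m<n+m _ (length-pos x≢[]))) w≤n)) ry y≢[]
  ... | y₁ , y₂ , c₁ , d₁ , refl , r₁ , r₂ , y₂≢[] , atom =
    x ++ map (c +_) y₁ , y₂ , c + c₁ , d₁ , slash-assoc x y₁ y₂ ,
    RG-slash rx r₁ , r₂ , y₂≢[] , atom

-- The common data of an atomic splitable word u·(v₁|v₂), the source, and of a
-- non-atomic unsplitable word (u·v₁)|v₂, the target.
record Triple : Set where
  field
    {u v₁ v₂} : List ℕ
    {h a b}   : ℕ
    ru        : RG 0 u h
    rv₁       : RG 0 v₁ a
    rv₂       : RG 0 v₂ b
    u≢[]      : u ≢ []
    v₂≢[]     : v₂ ≢ []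
    unsplit   : ¬ Splits u
    atomic    : ¬ Slashes v₂
    a<h       : a < h

  v : List ℕ
  v = v₁ ++ map (a +_) v₂

  s : List ℕ
  s = u ++ v₁

  source target : List ℕ
  source = u ++ v
  target = s ++ map (h +_) v₂

  rv : RG 0 v (a + b)
  rv = RG-slash rv₁ rv₂

  -- As `a < h`, appending `v₁` to `u` opens no block; this is why `target` raises `v₂` by `h`.
  rs : RG 0 s h
  rs = subst (RG 0 s) (m≥n⇒m⊔n≡m (<⇒≤ a<h)) (RG-concat ru rv₁)

  v≢[] : v ≢ []
  v≢[] = ++≢[]ʳ v₁ (map≢[] v₂≢[])

  s≢[] : s ≢ []
  s≢[] = ++≢[]ˡ u≢[]

  source-RG : RG 0 source (h ⊔ (a + b))
  source-RG = RG-concat ru rv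

  target-RG : RG 0 target (h + b)
  target-RG = RG-slash rs rv₂

  source-splits : Splits source
  source-splits = u , v , refl , u≢[] , v≢[] , _ , rv

  target-slashes : Slashes target
  target-slashes = slashes⁺ rs s≢[] v₂≢[]

  1≤h : 1 ≤ h
  1≤h = ≤-trans (s≤s z≤n) a<h

  -- The cut cannot fall inside the atomic factor, so `z` is a prefix of `v₁`. The bound serves both
  -- the atomicity of `source` and the maximality required by `IsR`.
  slash-count : ∀ {z t c} → z ++ t ≡ v → t ≢ [] → RG 0 z c → All (c ≤_) t → c ≤ a
  slash-count {z} eq t≢[] rz c≤t with atomic-last v₁ rv₁ atomic eq t≢[] rz c≤t
  ... | t′ , v₁≡ with RG-++⁻ z (subst (λ w → RG 0 w a) v₁≡ rv₁)
  ... | c′ , rz′ , rt′ = subst (_≤ a) (RG-functional rz′ rz) (RG-mono rt′)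

  -- A cut inside `u` would leave all of `v` after it, including the initial letter 0 of `v`,
  -- although `c ≥ 1`. Otherwise the left factor is `u ++ t`, where `t` has `e` labels and
  -- `c = h ⊔ e`. The next letter is at least `c` and, read within `v`, at most `e`; so `e = c`, the
  -- cut is a slash cut of `v`, and `h ≤ c ≤ a`.
  source-atomic : ¬ Slashes source
  source-atomic (x , z , eq , x≢[] , z≢[] , c , rx , c≤z) with ++-levi u x eq
  ... | inj₁ (t , refl , q) with RG-++⁻ u rx | RG-++⁻ t (subst (λ w → RG 0 w _) q rv)
  ... | k′ , ru′ , rt | e , rt₀ , rz = <⇒≱ a<h (≤-trans h≤c (subst (_≤ a) e≡c e≤a))
    where
    h≤c : h ≤ c
    h≤c = subst (_≤ c) (RG-functional ru′ ru) (RG-mono rt)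
    c≡h⊔e : c ≡ h ⊔ e
    c≡h⊔e = RG-functional rx (RG-concat ru rt₀)
    first : ∀ {z} → z ≢ [] → All (c ≤_) z → RG e z (a + b) → c ≤ e
    first z≢[] []        _  = contradiction refl z≢[]
    first z≢[] (c≤d ∷ _) rz = ≤-trans c≤d (RG-head rz)
    e≡c : e ≡ c
    e≡c = ≤-antisym (subst (e ≤_) (sym c≡h⊔e) (m≤n⊔m h e)) (first z≢[] c≤z rz)
    e≤a : e ≤ a
    e≤a = slash-count (sym q) z≢[] rt₀ (subst (λ c → All (c ≤_) z) (sym e≡c) c≤z)
  source-atomic (x , z , eq , x≢[] , z≢[] , c , rx , c≤z) | inj₂ (t , t≢[] , p , q) =
    no-zero (All.++⁻ʳ t (subst (All (c ≤_)) q c≤z)) rv v≢[]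
    where
    no-zero : ∀ {w l} → All (c ≤_) w → RG 0 w l → w ≢ [] → ⊥
    no-zero []        _ w≢[] = w≢[] refl
    no-zero (c≤d ∷ _) r _    = <⇒≱ (RG-nonEmpty rx x≢[]) (≤-trans c≤d (RG-head r))

  -- A suffix inside the raised `v₂` has no letter 0. Otherwise the suffix is `z` followed by the
  -- raised `v₂`, whose first letter is at least `h`, so `z` has at least `h` labels. But `u` is
  -- unsplitable, so `z` lies within `v₁` and has at most `a` labels.
  target-unsplit : ¬ Splits target
  target-unsplit (x , y , eq , x≢[] , y≢[] , e , ry) with ++-levi s x eq
  ... | inj₁ (t , refl , q) = no-zero (All.++⁻ʳ t (subst (All (h ≤_)) q (≥-shift h v₂))) ry y≢[]
    where
    no-zero : ∀ {w l} → All (h ≤_) w → RG 0 w l → w ≢ [] → ⊥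
    no-zero []        _ w≢[] = w≢[] refl
    no-zero (c≤d ∷ _) r _    = <⇒≱ 1≤h (≤-trans c≤d (RG-head r))
  ... | inj₂ (z , z≢[] , p , refl) with RG-++⁻ z ry
  ... | f , rz , r₂ with unsplit-first u unsplit x≢[] (f , rz) p
  ... | t , refl , v₁≡ with RG-++⁻ t (subst (λ w → RG 0 w a) v₁≡ rv₁)
  ... | g , _ , rz′ = <⇒≱ a<h (≤-trans h≤f f≤a)
    where
    first : ∀ {w} → w ≢ [] → RG f (map (h +_) w) e → h ≤ f
    first {[]}    w≢[] _ = contradiction refl w≢[]
    first {d ∷ _} _    r = ≤-trans (m≤m+n h d) (RG-head r)
    h≤f : h ≤ f
    h≤f = first v₂≢[] r₂
    f≤a : f ≤ a
    f≤a = subst (f ≤_) (RG-functional (RG-lift⁰ rz) rz′) (m≤n⊔m g f)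

  length-source≡target : length source ≡ length target
  length-source≡target = begin
    length (u ++ v₁ ++ map (a +_) v₂)           ≡⟨ cong length (++-assoc u v₁ _) ⟨
    length (s ++ map (a +_) v₂)                 ≡⟨ length-++ s ⟩
    length s + length (map (a +_) v₂)           ≡⟨ cong (length s +_) (length-map _ v₂) ⟩
    length s + length v₂                        ≡⟨ cong (length s +_) (length-map _ v₂) ⟨
    length s + length (map (h +_) v₂)           ≡⟨ length-++ s ⟨
    length target                               ∎
    where open ≡-Reasoning


-- Existence and uniqueness of the triple behind a word

factorSource : RG 0 w l → ¬ Slashes w → Splits w → ∃ λ T → w ≡ Triple.source T
factorSource {w} r atom (x , y , refl , x≢[] , y≢[] , ry)
  with firstUnsplit w (++≢[]ˡ x≢[])
... | u , v , eq , u≢[] , unsp , _ , rv with RG-++⁻ u (subst (λ w → RG 0 w _) eq r)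
... | k , ru , _ with lastAtomic v rv v≢[]
  where
  v≢[] : v ≢ []
  v≢[] refl = unsp (x , y , trans (sym (++-identityʳ u)) (sym eq) , x≢[] , y≢[] , ry)
... | v₁ , v₂ , a , b , refl , r₁ , r₂ , v₂≢[] , at with a <? k
... | yes a<k = record
  { ru = ru ; rv₁ = r₁ ; rv₂ = r₂ ; u≢[] = u≢[] ; v₂≢[] = v₂≢[]
  ; unsplit = unsp ; atomic = at ; a<h = a<k } , eq
-- Here `u ++ v₁` has `a` labels as well, so the shift of `v₂` is the right one for a slash cut of
-- the whole word.
... | no a≮k = contradiction
  (subst Slashes (trans (++-assoc u v₁ _) (sym eq))
    (slashes⁺ (subst (RG 0 _) (m≤n⇒m⊔n≡n (≮⇒≥ a≮k)) (RG-concat ru r₁)) (++≢[]ˡ u≢[]) v₂≢[]))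
  atom

factorTarget : RG 0 w l → ¬ Splits w → Slashes w → ∃ λ T → w ≡ Triple.target T
factorTarget {w} r unsp (x , z , refl , x≢[] , z≢[] , sl) with lastAtomic w r (++≢[]ˡ x≢[])
... | s , v₂ , k′ , b , eq , rs , r₂ , v₂≢[] , at with firstUnsplit s (s≢[] rs eq)
  where
  s≢[] : ∀ {s c} → RG 0 s c → w ≡ s ++ map (c +_) v₂ → s ≢ []
  s≢[] [] eq _ = at (x , z , sym (trans eq (map-id v₂)) , x≢[] , z≢[] , sl)
... | u , v₁ , refl , u≢[] , un , a , r₁ with RG-++⁻ u rs
... | k , ru , _ with a <? k | RG-functional rs (RG-concat ru r₁)
... | yes a<k | refl = record
  { ru = ru ; rv₁ = r₁ ; rv₂ = r₂ ; u≢[] = u≢[] ; v₂≢[] = v₂≢[]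
  ; unsplit = un ; atomic = at ; a<h = a<k } ,
  trans eq (cong (λ k → (u ++ v₁) ++ map (k +_) v₂) (m≥n⇒m⊔n≡m (<⇒≤ a<k)))
-- Here the shift of `v₂` is the block count of `v₁` alone, so `v₁|v₂` is a right factor of a split.
... | no a≮k | refl = contradiction
  (u , v₁ ++ map (a +_) v₂ ,
   trans eq (trans (cong (λ k → (u ++ v₁) ++ map (k +_) v₂) (m≤n⇒m⊔n≡n (≮⇒≥ a≮k))) (++-assoc u v₁ _)) ,
   u≢[] , ++≢[]ʳ v₁ (map≢[] v₂≢[]) , _ , RG-slash r₁ r₂)
  unsp

-- Only the words are compared: they determine the counts, and the proofs stored in two triples need
-- not agree.
record _∼_ (T T′ : Triple) : Set where
  constructor same
  private
    module T  = Triple T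
    module T′ = Triple T′
  field
    u≡  : T.u ≡ T′.u
    v₁≡ : T.v₁ ≡ T′.v₁
    v₂≡ : T.v₂ ≡ T′.v₂

prefix-antisym : ∀ (x : List ℕ) {y s t} → y ≡ x ++ s → x ≡ y ++ t → x ≡ y
prefix-antisym x {y} {s} {t} refl q
  with ++-conicalˡ s t (sym (++-cancelˡ x [] (s ++ t) (trans (++-identityʳ x) (trans q (++-assoc x s t)))))
... | refl = sym (++-identityʳ x)

-- By `unsplit-first`, each of `u` and `u′` is a prefix of the other. The next lemma argues likewise
-- with `atomic-last`.
unsplit-unique : ∀ {u v u′ v′ : List ℕ} → ¬ Splits u → ¬ Splits u′ → u ≢ [] → u′ ≢ [] → RGF v → RGF v′ →
                 u ++ v ≡ u′ ++ v′ → u ≡ u′ × v ≡ v′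
unsplit-unique {u} {v} {u′} {v′} un un′ ne ne′ r r′ eq
  with unsplit-first u un ne′ r′ eq | unsplit-first u′ un′ ne r (sym eq)
... | t , p , _ | t′ , p′ , _ with prefix-antisym u p p′
... | refl = refl , ++-cancelˡ u v v′ eq

atomic-unique : ∀ {x y x′ y′ : List ℕ} {c c′} → ¬ Slashes y → ¬ Slashes y′ → y ≢ [] → y′ ≢ [] →
                RG 0 x c → RG 0 x′ c′ → x ++ map (c +_) y ≡ x′ ++ map (c′ +_) y′ → x ≡ x′ × y ≡ y′
atomic-unique {x} {y} {x′} {y′} {c} {c′} at at′ ne ne′ r r′ eq
  with atomic-last x r at (sym eq) (map≢[] ne′) r′ (≥-shift c′ y′)
     | atomic-last x′ r′ at′ eq (map≢[] ne) r (≥-shift c y)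
... | t , p | t′ , p′ with prefix-antisym x p′ p
... | refl with RG-functional r r′
... | refl = refl , map-injective (+-cancelˡ-≡ c _ _) (++-cancelˡ x _ _ eq)

source-injective : ∀ T T′ → Triple.source T ≡ Triple.source T′ → T ∼ T′
source-injective T T′ eq
  with unsplit-unique T.unsplit T′.unsplit T.u≢[] T′.u≢[] (_ , T.rv) (_ , T′.rv) eq
  where module T = Triple T; module T′ = Triple T′
... | u≡ , v≡ with atomic-unique T.atomic T′.atomic T.v₂≢[] T′.v₂≢[] T.rv₁ T′.rv₁ v≡
  where module T = Triple T; module T′ = Triple T′
... | v₁≡ , v₂≡ = same u≡ v₁≡ v₂≡

target-injective : ∀ T T′ → Triple.target T ≡ Triple.target T′ → T ∼ T′
target-injective T T′ eq
  with atomic-unique T.atomic T′.atomic T.v₂≢[] T′.v₂≢[] T.rs T′.rs eq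
  where module T = Triple T; module T′ = Triple T′
... | s≡ , v₂≡ with unsplit-unique T.unsplit T′.unsplit T.u≢[] T′.u≢[] (_ , T.rv₁) (_ , T′.rv₁) s≡
  where module T = Triple T; module T′ = Triple T′
... | u≡ , v₁≡ = same u≡ v₁≡ v₂≡

source-cong : ∀ T T′ → T ∼ T′ → Triple.source T ≡ Triple.source T′
source-cong T T′ (same refl refl refl) with RG-functional (Triple.rv₁ T) (Triple.rv₁ T′)
... | refl = refl

target-cong : ∀ T T′ → T ∼ T′ → Triple.target T ≡ Triple.target T′
target-cong T T′ (same refl refl refl) with RG-functional (Triple.ru T) (Triple.ru T′)
... | refl = refl

-- Words and partitions

positions : ℕ → ℕ → List ℕ → List ℕ
positions p c [] = []
positions p c (d ∷ w) with c ≟ d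
... | yes _ = p ∷ positions (suc p) c w
... | no _  = positions (suc p) c w

-- The first k blocks of the set partition of {p,p+1,…} whose label word is w.
blocks : ℕ → ℕ → List ℕ → Blocks
blocks p k w = applyUpTo (λ c → positions p c w) k

positions-++ : ∀ p c x {y} → positions p c (x ++ y) ≡ positions p c x ++ positions (p + length x) c y
positions-++ p c []      {y} = cong (λ q → positions q c y) (sym (+-identityʳ p))
positions-++ p c (d ∷ x) {y} rewrite +-suc p (length x) with c ≟ d
... | yes _ = cong (p ∷_) (positions-++ (suc p) c x)
... | no _  = positions-++ (suc p) c x

positions-+ : ∀ p c m w → map (_+ m) (positions p c w) ≡ positions (p + m) c w
positions-+ p c m [] = refl
positions-+ p c m (d ∷ w) with c ≟ d
... | yes _ = cong (p + m ∷_) (positions-+ (suc p) c m w)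
... | no _  = positions-+ (suc p) c m w

positions-relabel : ∀ p a c w → positions p (a + c) (map (a +_) w) ≡ positions p c w
positions-relabel p a c [] = refl
positions-relabel p a c (d ∷ w) with a + c ≟ a + d | c ≟ d
... | yes _  | yes _  = cong (p ∷_) (positions-relabel (suc p) a c w)
... | yes eq | no c≢d = contradiction (+-cancelˡ-≡ a c d eq) c≢d
... | no neq | yes eq = contradiction (cong (a +_) eq) neq
... | no _   | no _   = positions-relabel (suc p) a c w

positions-∉ : ∀ p {c} w → c ∉ w → positions p c w ≡ []
positions-∉ p [] _ = refl
positions-∉ p {c} (d ∷ w) c∉w with c ≟ d
... | yes eq = contradiction (here eq) c∉w
... | no _   = positions-∉ (suc p) w (c∉w ∘ there)

positions-∈ : ∀ p {c} w → c ∈ w → positions p c w ≢ []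
positions-∈ p {c} (d ∷ w) c∈w with c ≟ d | c∈w
... | yes _  | _         = λ ()
... | no c≢d | here c≡d  = contradiction c≡d c≢d
... | no _   | there c∈w = positions-∈ (suc p) w c∈w

positions-label : ∀ p {c} w {x} → x ∈ positions p c w → c ∈ w
positions-label p {c} (d ∷ w) x∈ with c ≟ d
... | yes c≡d = here c≡d
... | no _    = there (positions-label (suc p) w x∈)

positions-range : ∀ p c w → All (λ x → p ≤ x × x < p + length w) (positions p c w)
positions-range p c [] = []
positions-range p c (d ∷ w) rewrite +-suc p (length w) with c ≟ d
... | yes _ = (≤-refl , s≤s (m≤m+n p _)) ∷ All.map (map₁ <⇒≤) (positions-range (suc p) c w)
... | no _  = All.map (map₁ <⇒≤) (positions-range (suc p) c w)

∈-positions-range : ∀ p {c} w {x} → x ∈ positions p c w → p ≤ x × x < p + length w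
∈-positions-range p w = All.lookup (positions-range p _ w)

positions-increasing : ∀ p c w → AllPairs _<_ (positions p c w)
positions-increasing p c [] = []
positions-increasing p c (d ∷ w) with c ≟ d
... | yes _ = All.map proj₁ (positions-range (suc p) c w) ∷ positions-increasing (suc p) c w
... | no _  = positions-increasing (suc p) c w

positions-disjoint : ∀ p {c d} w {x} → x ∈ positions p c w → x ∈ positions p d w → c ≡ d
positions-disjoint p {c} {d} (e ∷ w) x∈c x∈d with c ≟ e | d ≟ e
... | yes refl | yes refl = refl
positions-disjoint p (e ∷ w) (here refl) x∈d | yes _ | no _ =
  contradiction (proj₁ (∈-positions-range (suc p) w x∈d)) (<-irrefl refl)
positions-disjoint p (e ∷ w) (there x∈c) x∈d | yes _ | no _ = positions-disjoint (suc p) w x∈c x∈d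
positions-disjoint p (e ∷ w) x∈c (here refl) | no _ | yes _ =
  contradiction (proj₁ (∈-positions-range (suc p) w x∈c)) (<-irrefl refl)
positions-disjoint p (e ∷ w) x∈c (there x∈d) | no _ | yes _ = positions-disjoint (suc p) w x∈c x∈d
positions-disjoint p (e ∷ w) x∈c x∈d | no _ | no _ = positions-disjoint (suc p) w x∈c x∈d

positions-cover : ∀ p w {x} → p ≤ x → x < p + length w → ∃ λ c → c ∈ w × x ∈ positions p c w
positions-cover p [] p≤x x< = contradiction (≤-<-trans p≤x x<) (<-irrefl (sym (+-identityʳ p)))
positions-cover p (d ∷ w) p≤x x< with m≤n⇒m<n∨m≡n p≤x
... | inj₂ refl = d , here refl , first
  where
  first : p ∈ positions p d (d ∷ w)
  first with d ≟ d
  ... | yes _  = here refl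
  ... | no d≢d = contradiction refl d≢d
... | inj₁ p<x with positions-cover (suc p) w p<x (<-≤-trans x< (≤-reflexive (+-suc p _)))
... | c , c∈w , x∈ = c , there c∈w , later
  where
  later : _ ∈ positions p c (d ∷ w)
  later with c ≟ d
  ... | yes _ = there x∈
  ... | no _  = x∈

minElt-∈ : ∀ {B} → B ≢ [] → minElt B ∈ B
minElt-∈ {[]}    B≢[] = contradiction refl B≢[]
minElt-∈ {_ ∷ _} _    = here refl

-- Labels from `k` on are opened in increasing order, so `c` occurs before `d` does.
positions-ordered : ∀ p {c d} → RG k w l → k ≤ c → c < d → d < l →
                    minElt (positions p c w) < minElt (positions p d w)
positions-ordered p [] k≤c c<d d<l = contradiction (≤-<-trans k≤c (<-trans c<d d<l)) (<-irrefl refl)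
positions-ordered p {c} {d} (old {c = e} e<k r) k≤c c<d d<l with c ≟ e | d ≟ e
... | yes refl | _        = contradiction k≤c (<⇒≱ e<k)
... | no _     | yes refl = contradiction (≤-trans k≤c (<⇒≤ c<d)) (<⇒≱ e<k)
... | no _     | no _     = positions-ordered (suc p) r k≤c c<d d<l
positions-ordered {w = _ ∷ w} p {c} {d} (new {c = e} refl r) k≤c c<d d<l with c ≟ e | d ≟ e
... | yes refl | yes refl = contradiction c<d (<-irrefl refl)
... | yes refl | no _     = proj₁ (∈-positions-range (suc p) w
                              (minElt-∈ (positions-∈ (suc p) w (RG-surjective r c<d d<l))))
... | no _     | yes refl = contradiction k≤c (<⇒≱ c<d)
... | no c≢e   | no _     = positions-ordered (suc p) r (≤∧≢⇒< k≤c (c≢e ∘ sym)) c<d d<l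

∈-concat-applyUpTo⁺ : ∀ (F : ℕ → Block) {c n x} → c < n → x ∈ F c → x ∈ concat (applyUpTo F n)
∈-concat-applyUpTo⁺ F c<n x∈ = ∈-concat⁺′ x∈ (∈-applyUpTo⁺ F c<n)

∈-concat-applyUpTo⁻ : ∀ (F : ℕ → Block) {n x} → x ∈ concat (applyUpTo F n) → ∃ λ c → c < n × x ∈ F c
∈-concat-applyUpTo⁻ F x∈ with ∈-concat⁻′ _ x∈
... | B , x∈B , B∈ with ∈-applyUpTo⁻ F B∈
... | c , c<n , refl = c , c<n , x∈B

∈-blocks⁺ : ∀ p → RG 0 w l → ∀ {x} → p ≤ x → x < p + length w → x ∈ concat (blocks p l w)
∈-blocks⁺ {w} p r p≤x x< with positions-cover p w p≤x x<
... | c , c∈w , x∈ = ∈-concat-applyUpTo⁺ _ (All.lookup (RG-all< r) c∈w) x∈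

∈-blocks⁻ : ∀ p {l x} w → x ∈ concat (blocks p l w) → p ≤ x × x < p + length w
∈-blocks⁻ p {l} w x∈ with ∈-concat-applyUpTo⁻ (λ c → positions p c w) {l} x∈
... | _ , _ , x∈c = ∈-positions-range p w x∈c

blocks-partition : RG 0 w l → PartitionOf[ length w ] (blocks 1 l w)
blocks-partition {w} {l} r = record
  { nonEmpty   = All.applyUpTo⁺₁ _ l λ c<l → positions-∈ 1 w (RG-surjective r z≤n c<l)
  ; increasing = All.applyUpTo⁺₂ _ l λ c → positions-increasing 1 c w
  ; ordered    = AllPairs.applyUpTo⁺₁ _ l (positions-ordered 1 r z≤n)
  ; disjoint   = AllPairs.applyUpTo⁺₁ _ l λ c<d _ (x∈c , x∈d) →
                   <⇒≢ c<d (positions-disjoint 1 w x∈c x∈d)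
  ; covers     = λ x → mk⇔ (map₂ ≤-pred ∘ ∈-blocks⁻ 1 {l} w) λ (1≤x , x≤n) → ∈-blocks⁺ 1 r 1≤x (s≤s x≤n)
  }

applyUpTo-cong : ∀ {F G : ℕ → Block} n → (∀ {c} → c < n → F c ≡ G c) → applyUpTo F n ≡ applyUpTo G n
applyUpTo-cong zero    eq = refl
applyUpTo-cong (suc n) eq = cong₂ _∷_ (eq (s≤s z≤n)) (applyUpTo-cong n (eq ∘ s≤s))

applyUpTo-+ : ∀ (F : ℕ → Block) m n → applyUpTo F (m + n) ≡ applyUpTo F m ++ applyUpTo (F ∘ (m +_)) n
applyUpTo-+ F zero    n = refl
applyUpTo-+ F (suc m) n = cong (F 0 ∷_) (applyUpTo-+ (F ∘ suc) m n)

drop-applyUpTo : ∀ (F : ℕ → Block) m n → drop m (applyUpTo F (m + n)) ≡ applyUpTo (F ∘ (m +_)) n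
drop-applyUpTo F zero    n = refl
drop-applyUpTo F (suc m) n = drop-applyUpTo (F ∘ suc) m n

-- Recovering the word from a partition

blockAt : Blocks → ℕ → Block
blockAt []      _       = []
blockAt (B ∷ _) zero    = B
blockAt (_ ∷ π) (suc c) = blockAt π c

applyUpTo-blockAt : ∀ π → applyUpTo (blockAt π) (length π) ≡ π
applyUpTo-blockAt []      = refl
applyUpTo-blockAt (B ∷ π) = cong (B ∷_) (applyUpTo-blockAt π)

blockAt-applyUpTo : ∀ {F : ℕ → Block} n → (∀ c → n ≤ c → F c ≡ []) → ∀ c → blockAt (applyUpTo F n) c ≡ F c
blockAt-applyUpTo zero    F≡[] c       = sym (F≡[] c z≤n)
blockAt-applyUpTo (suc n) F≡[] zero    = refl
blockAt-applyUpTo (suc n) F≡[] (suc c) = blockAt-applyUpTo n (λ c n≤c → F≡[] (suc c) (s≤s n≤c)) c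

blockAt-All : ∀ {P : Block → Set} {π} → All P π → ∀ {c} → c < length π → P (blockAt π c)
blockAt-All (p ∷ _)  {zero}  _         = p
blockAt-All (_ ∷ ps) {suc c} (s≤s c<n) = blockAt-All ps c<n

blockAt-AllPairs : ∀ {R : Block → Block → Set} {π} → AllPairs R π → ∀ {c d} → c < d → d < length π →
                   R (blockAt π c) (blockAt π d)
blockAt-AllPairs (p ∷ _)  {zero}  {suc d} _         (s≤s d<n) = blockAt-All p d<n
blockAt-AllPairs (_ ∷ ps) {suc c} {suc d} (s≤s c<d) (s≤s d<n) = blockAt-AllPairs ps c<d d<n

∈-blockAt⇒< : ∀ π {c x} → x ∈ blockAt π c → c < length π
∈-blockAt⇒< (_ ∷ _) {zero}  _  = s≤s z≤n
∈-blockAt⇒< (_ ∷ π) {suc c} x∈ = s≤s (∈-blockAt⇒< π x∈)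

∈-concat⇒blockAt : ∀ π {x} → x ∈ concat π → ∃ λ c → c < length π × x ∈ blockAt π c
∈-concat⇒blockAt π x∈ = ∈-concat-applyUpTo⁻ (blockAt π)
  (subst (λ ρ → _ ∈ concat ρ) (sym (applyUpTo-blockAt π)) x∈)

∈-blockAt⇒concat : ∀ π {c x} → x ∈ blockAt π c → x ∈ concat π
∈-blockAt⇒concat π x∈ = subst (λ ρ → _ ∈ concat ρ) (applyUpTo-blockAt π)
  (∈-concat-applyUpTo⁺ (blockAt π) (∈-blockAt⇒< π x∈) x∈)

blockAt-blocks : ∀ p → RG 0 w l → ∀ c → blockAt (blocks p l w) c ≡ positions p c w
blockAt-blocks {w} {l} p r = blockAt-applyUpTo l λ c l≤c →
  positions-∉ p w λ c∈w → <⇒≱ (All.lookup (RG-all< r) c∈w) l≤c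

-- The first letter is the label whose block contains `p`.
positions-injective : ∀ p w w′ → (∀ c → positions p c w ≡ positions p c w′) → w ≡ w′
positions-injective p []      []        eq = refl
positions-injective p []      (d ∷ w′)  eq = contradiction (sym (eq d)) (positions-∈ p (d ∷ w′) (here refl))
positions-injective p (d ∷ w) []        eq = contradiction (eq d) (positions-∈ p (d ∷ w) (here refl))
positions-injective p (d ∷ w) (d′ ∷ w′) eq with d ≟ d′
... | yes refl = cong (d ∷_) (positions-injective (suc p) w w′ tails)
  where
  tails : ∀ c → positions (suc p) c w ≡ positions (suc p) c w′
  tails c with c ≟ d | eq c
  ... | yes _ | e = ∷-injectiveʳ e
  ... | no _  | e = e
... | no d≢d′ with d ≟ d | d ≟ d′ | eq d
... | no d≢d | _        | _ = contradiction refl d≢d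
... | yes _  | yes d≡d′ | _ = contradiction d≡d′ d≢d′
... | yes _  | no _     | e = contradiction
  (proj₁ (∈-positions-range (suc p) w′ (subst (p ∈_) e (here refl)))) (<-irrefl refl)

blocks-injective : RG 0 w l → RG 0 x m → blocks 1 l w ≡ blocks 1 m x → w ≡ x
blocks-injective {w} {x = x} r s eq = positions-injective 1 w x λ c →
  trans (sym (blockAt-blocks 1 r c)) (trans (cong (λ π → blockAt π c) eq) (blockAt-blocks 1 s c))

blocks-cong : RG 0 w l → RG 0 x m → w ≡ x → blocks 1 l w ≡ blocks 1 m x
blocks-cong {w} r s refl = cong (λ l → blocks 1 l w) (RG-functional r s)

-- The state of a partition after its elements below p have been deleted: k
-- blocks have been met so far, and only the other ones are still in order.
record Remaining (p n k l : ℕ) (F : ℕ → Block) : Set where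
  field
    increasing : ∀ c → AllPairs _<_ (F c)
    range      : ∀ {c x} → x ∈ F c → p ≤ x × x < p + n
    cover      : ∀ {x} → p ≤ x → x < p + n → ∃ λ c → c < l × x ∈ F c
    disjoint   : ∀ {c d x} → x ∈ F c → x ∈ F d → c ≡ d
    nonEmpty   : ∀ {c} → k ≤ c → c < l → F c ≢ []
    ordered    : ∀ {c d} → k ≤ c → c < d → d < l → minElt (F c) < minElt (F d)
    k≤l        : k ≤ l

strip : ℕ → Block → Block
strip p [] = []
strip p (x ∷ B) with x ≟ p
... | yes _ = B
... | no _  = x ∷ B

strip-⊆ : ∀ p B {x} → x ∈ strip p B → x ∈ B
strip-⊆ p (y ∷ B) x∈ with y ≟ p
... | yes _ = there x∈
... | no _  = x∈

strip-∈ : ∀ p B {x} → x ∈ B → x ≢ p → x ∈ strip p B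
strip-∈ p (y ∷ B) x∈ x≢p with y ≟ p
strip-∈ p (y ∷ B) (here refl) x≢p | yes y≡p = contradiction y≡p x≢p
strip-∈ p (y ∷ B) (there x∈)  x≢p | yes _   = x∈
... | no _ = x∈

strip-∉ : ∀ p B → p ∉ B → strip p B ≡ B
strip-∉ p [] _ = refl
strip-∉ p (y ∷ B) p∉ with y ≟ p
... | yes y≡p = contradiction (here (sym y≡p)) p∉
... | no _    = refl

strip-increasing : ∀ p {B} → AllPairs _<_ B → AllPairs _<_ (strip p B)
strip-increasing p [] = []
strip-increasing p {y ∷ B} (q ∷ qs) with y ≟ p
... | yes _ = qs
... | no _  = q ∷ qs

strip-head : ∀ p {B} → AllPairs _<_ B → (∀ {x} → x ∈ B → p ≤ x) → p ∈ B → B ≡ p ∷ strip p B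
strip-head p {y ∷ B} (q ∷ qs) p≤ p∈ with y ≟ p | p∈
... | yes refl | _         = refl
... | no y≢p   | here p≡y  = contradiction (sym p≡y) y≢p
... | no _     | there p∈B = contradiction (All.lookup q p∈B) (≤⇒≯ (p≤ (here refl)))

strip-> : ∀ p {B} → AllPairs _<_ B → (∀ {x} → x ∈ B → p ≤ x) → ∀ {x} → x ∈ strip p B → p < x
strip-> p {y ∷ B} (q ∷ qs) p≤ x∈ with y ≟ p
... | yes refl = All.lookup q x∈
strip-> p {y ∷ B} (q ∷ qs) p≤ (here refl) | no y≢p = ≤∧≢⇒< (p≤ (here refl)) (y≢p ∘ sym)
strip-> p {y ∷ B} (q ∷ qs) p≤ (there x∈)  | no _   = ≤-<-trans (p≤ (here refl)) (All.lookup q x∈)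

-- Used with `k′ = k` when `p` lies in a block already met, and with `k′ = suc k` when it opens
-- block `k`. Blocks from `k′` on do not contain `p` and keep their minima.
remaining-step : ∀ {p n k k′ l c F} → Remaining p (suc n) k l F → p ∈ F c → c < k′ → k ≤ k′ → k′ ≤ l →
                 Remaining (suc p) n k′ l (strip p ∘ F)
remaining-step {p} {n} {k} {k′} {l} {c} {F} R p∈c c<k′ k≤k′ k′≤l = record
  { increasing = λ d → strip-increasing p (R.increasing d)
  ; range      = λ {d} x∈ → strip-> p (R.increasing d) (proj₁ ∘ R.range) x∈ ,
                            <-≤-trans (proj₂ (R.range (strip-⊆ p (F d) x∈))) (≤-reflexive (+-suc p n))
  ; cover      = λ p<x x< → map₂ (map₂ λ x∈ → strip-∈ p _ x∈ (<⇒≢ p<x ∘ sym))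
                              (R.cover (<⇒≤ p<x) (<-≤-trans x< (≤-reflexive (sym (+-suc p n)))))
  ; disjoint   = λ x∈ y∈ → R.disjoint (strip-⊆ p _ x∈) (strip-⊆ p _ y∈)
  ; nonEmpty   = λ k′≤d d<l → subst (_≢ []) (sym (same-block k′≤d)) (R.nonEmpty (≤-trans k≤k′ k′≤d) d<l)
  ; ordered    = λ k′≤d d<e e<l → subst₂ (λ B C → minElt B < minElt C)
      (sym (same-block k′≤d)) (sym (same-block (≤-trans k′≤d (<⇒≤ d<e))))
      (R.ordered (≤-trans k≤k′ k′≤d) d<e e<l)
  ; k≤l        = k′≤l
  }
  where
  module R = Remaining R
  same-block : ∀ {d} → k′ ≤ d → strip p (F d) ≡ F d
  same-block {d} k′≤d = strip-∉ p (F d) λ p∈d → <⇒≢ (<-≤-trans c<k′ k′≤d) (R.disjoint p∈c p∈d)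

restore-block : ∀ {p n k l F c w} → Remaining p n k l F → p ∈ F c →
                (∀ d → strip p (F d) ≡ positions (suc p) d w) → ∀ d → F d ≡ positions p d (c ∷ w)
restore-block {p} {F = F} {c} R p∈c eq d with d ≟ c
... | yes refl = trans (strip-head p (Remaining.increasing R c) (proj₁ ∘ Remaining.range R) p∈c)
                       (cong (p ∷_) (eq c))
... | no d≢c   = trans (sym (strip-∉ p (F d) λ p∈d → d≢c (Remaining.disjoint R p∈d p∈c))) (eq d)

-- If `c > k`, block `k` would have a minimum below `p`, the least remaining element.
first-new-block : ∀ {p n k l F c} → Remaining p n k l F → p ∈ F c → c < l → k ≤ c → c ≡ k
first-new-block {p} {k = k} {F = F} {c} R p∈c c<l k≤c with m≤n⇒m<n∨m≡n k≤c
... | inj₂ k≡c = sym k≡c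
... | inj₁ k<c = contradiction
  (subst (λ B → minElt (F k) < minElt B) (strip-head p (R.increasing c) (proj₁ ∘ R.range) p∈c)
    (R.ordered ≤-refl k<c c<l))
  (≤⇒≯ (proj₁ (R.range (minElt-∈ (R.nonEmpty ≤-refl (<-trans k<c c<l))))))
  where module R = Remaining R

-- The next letter is the index of the block of `p`: old if below `k`, otherwise exactly `k`. Once
-- no element remains, all blocks are empty, and nonemptiness of the unmet ones forces `k = l`.
remaining-word : ∀ n {p k l F} → Remaining p n k l F →
                 ∃ λ w → length w ≡ n × RG k w l × (∀ c → F c ≡ positions p c w)
remaining-word zero {p} {k} {l} {F} R = [] , refl , subst (RG k []) k≡l [] , empty
  where
  module R = Remaining R
  no-element : ∀ {c x} → x ∈ F c → ⊥
  no-element x∈ with R.range x∈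
  ... | p≤x , x<p = <⇒≱ x<p (subst (_≤ _) (sym (+-identityʳ p)) p≤x)
  empty : ∀ c → F c ≡ []
  empty c with F c | no-element {c}
  ... | []    | _  = refl
  ... | _ ∷ _ | ∉F = ⊥-elim (∉F (here refl))
  k≡l : k ≡ l
  k≡l with m≤n⇒m<n∨m≡n R.k≤l
  ... | inj₁ k<l = contradiction (empty k) (R.nonEmpty ≤-refl k<l)
  ... | inj₂ eq  = eq
remaining-word (suc n) {k = k} R with Remaining.cover R ≤-refl (m<m+n _ (s≤s z≤n))
... | c , c<l , p∈c with c <? k
... | yes c<k with remaining-word n (remaining-step R p∈c c<k ≤-refl (Remaining.k≤l R))
... | w , refl , r , eq = c ∷ w , refl , old c<k r , restore-block R p∈c eq
remaining-word (suc n) R | c , c<l , p∈c | no c≮k with first-new-block R p∈c c<l (≮⇒≥ c≮k)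
... | refl with remaining-word n (remaining-step R p∈c ≤-refl (n≤1+n c) c<l)
... | w , refl , r , eq = c ∷ w , refl , new refl r , restore-block R p∈c eq

partition-word : ∀ {n π} → PartitionOf[ n ] π →
                 ∃ λ w → length w ≡ n × RG 0 w (length π) × π ≡ blocks 1 (length π) w
partition-word {n} {π} P with remaining-word n {1} {0} {length π} {blockAt π} record
  { increasing = increasing
  ; range      = λ x∈ → map₂ s≤s (Equivalence.to (P.covers _) (∈-blockAt⇒concat π x∈))
  ; cover      = λ 1≤x x< → ∈-concat⇒blockAt π (Equivalence.from (P.covers _) (1≤x , ≤-pred x<))
  ; disjoint   = disjoint
  ; nonEmpty   = λ _ → blockAt-All P.nonEmpty
  ; ordered    = λ _ → blockAt-AllPairs P.ordered
  ; k≤l        = z≤n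
  }
  where
  module P = IsPartition P
  increasing : ∀ c → AllPairs _<_ (blockAt π c)
  increasing c with c <? length π
  ... | yes c<l = blockAt-All P.increasing c<l
  ... | no c≮l with blockAt π c | ∈-blockAt⇒< π {c}
  ... | []    | _ = []
  ... | _ ∷ _ | h = contradiction (h (here refl)) c≮l
  disjoint : ∀ {c d x} → x ∈ blockAt π c → x ∈ blockAt π d → c ≡ d
  disjoint {c} {d} x∈c x∈d with <-cmp c d
  ... | tri< c<d _ _ = contradiction (x∈c , x∈d) (blockAt-AllPairs P.disjoint c<d (∈-blockAt⇒< π x∈d))
  ... | tri≈ _ c≡d _ = c≡d
  ... | tri> _ _ d<c = contradiction (x∈d , x∈c) (blockAt-AllPairs P.disjoint d<c (∈-blockAt⇒< π x∈c))
... | w , len , r , eq = w , len , r , trans (sym (applyUpTo-blockAt π)) (applyUpTo-cong (length π) λ _ → eq _)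

-- Products

blocks-⊞ : ∀ p k w m → blocks p k w ⊞ m ≡ blocks (p + m) k w
blocks-⊞ p k w m = trans (map-applyUpTo _ _ k) (applyUpTo-cong k λ {c} _ → positions-+ p c m w)

⊞-⊟ : ∀ π m → (π ⊞ m) ⊟ m ≡ π
⊞-⊟ π m = trans (sym (map-∘ π)) (map-id-local (All.universal undo π))
  where
  undo : ∀ B → map (_∸ m) (map (_+ m) B) ≡ B
  undo B = trans (sym (map-∘ B)) (map-id-local (All.universal (λ x → m+n∸n≡m x m) B))

⊟-⊞ : ∀ {π m} → All (All (m ≤_)) π → (π ⊟ m) ⊞ m ≡ π
⊟-⊞ {π} {m} m≤π = trans (sym (map-∘ π)) (map-id-local (All.map undo m≤π))
  where
  undo : ∀ {B} → All (m ≤_) B → map (_+ m) (map (_∸ m) B) ≡ B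
  undo {B} m≤B = trans (sym (map-∘ B)) (map-id-local (All.map m∸n+n≡m m≤B))

blocks-⊟ : ∀ p k w m → blocks (p + m) k w ⊟ m ≡ blocks p k w
blocks-⊟ p k w m = trans (cong (_⊟ m) (sym (blocks-⊞ p k w m))) (⊞-⊟ (blocks p k w) m)

length-unionBlocks : ∀ π σ → length (unionBlocks π σ) ≡ length π ⊔ length σ
length-unionBlocks []      σ       = refl
length-unionBlocks (B ∷ π) []      = refl
length-unionBlocks (B ∷ π) (C ∷ σ) = cong suc (length-unionBlocks π σ)

-- The default `[]` past the end makes the split product a blockwise concatenation, whichever factor
-- has more blocks.
blockAt-unionBlocks : ∀ π σ c → blockAt (unionBlocks π σ) c ≡ blockAt π c ++ blockAt σ c
blockAt-unionBlocks []      σ       c       = refl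
blockAt-unionBlocks (B ∷ π) []      c       = sym (++-identityʳ _)
blockAt-unionBlocks (B ∷ π) (C ∷ σ) zero    = refl
blockAt-unionBlocks (B ∷ π) (C ∷ σ) (suc c) = blockAt-unionBlocks π σ c

unionBlocks-blocks : RG 0 x k → RG 0 y l →
                     unionBlocks (blocks 1 k x) (blocks (suc (length x)) l y) ≡ blocks 1 (k ⊔ l) (x ++ y)
unionBlocks-blocks {x} {k} {y} {l} r s = begin
  U                               ≡⟨ applyUpTo-blockAt U ⟨
  applyUpTo (blockAt U) (length U) ≡⟨ cong (applyUpTo _) size ⟩
  applyUpTo (blockAt U) (k ⊔ l)   ≡⟨ applyUpTo-cong (k ⊔ l) (λ {c} _ → at c) ⟩
  blocks 1 (k ⊔ l) (x ++ y)       ∎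
  where
  open ≡-Reasoning
  U = unionBlocks (blocks 1 k x) (blocks (suc (length x)) l y)
  size : length U ≡ k ⊔ l
  size = trans (length-unionBlocks (blocks 1 k x) _)
               (cong₂ _⊔_ (length-applyUpTo _ k) (length-applyUpTo _ l))
  at : ∀ c → blockAt U c ≡ positions 1 c (x ++ y)
  at c = trans (blockAt-unionBlocks (blocks 1 k x) _ c)
         (trans (cong₂ _++_ (blockAt-blocks 1 r c) (blockAt-blocks _ s c)) (sym (positions-++ 1 c x)))

split-blocks : RG 0 x k → RG 0 y l →
               split (length x) (blocks 1 k x) (blocks 1 l y) ≡ blocks 1 (k ⊔ l) (x ++ y)
split-blocks {x} {k} {y} {l} r s =
  trans (cong (unionBlocks (blocks 1 k x)) (blocks-⊞ 1 l y (length x))) (unionBlocks-blocks r s)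

slash-blocks : RG 0 x k → RG 0 y l →
               slash (length x) (blocks 1 k x) (blocks 1 l y) ≡ blocks 1 (k + l) (x ++ map (k +_) y)
slash-blocks {x} {k} {y} {l} r s = begin
  blocks 1 k x ++ (blocks 1 l y ⊞ length x)              ≡⟨ cong (blocks 1 k x ++_) (blocks-⊞ 1 l y _) ⟩
  blocks 1 k x ++ blocks (suc (length x)) l y            ≡⟨ cong₂ _++_ (applyUpTo-cong k left)
                                                                  (applyUpTo-cong l λ {c} _ → right c) ⟩
  applyUpTo F k ++ applyUpTo (F ∘ (k +_)) l              ≡⟨ applyUpTo-+ F k l ⟨
  blocks 1 (k + l) (x ++ map (k +_) y)                   ∎
  where
  open ≡-Reasoning
  F = λ c → positions 1 c (x ++ map (k +_) y)
  left : ∀ {c} → c < k → positions 1 c x ≡ F c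
  left {c} c<k = sym (trans (positions-++ 1 c x) (trans (cong (positions 1 c x ++_)
    (positions-∉ _ _ λ c∈ → <⇒≱ c<k (All.lookup (≥-shift k y) c∈))) (++-identityʳ _)))
  right : ∀ c → positions (suc (length x)) c y ≡ F (k + c)
  right c = sym (trans (positions-++ 1 (k + c) x)
    (cong₂ _++_ (positions-∉ 1 x λ c∈ → <⇒≱ (All.lookup (RG-all< r) c∈) (m≤m+n k c))
                (positions-relabel _ k c y)))

≢[]-length : 1 ≤ length x → x ≢ []
≢[]-length {_ ∷ _} _ ()

splitable⁻ : RG 0 w l → Splitable (blocks 1 l w) → Splits w
splitable⁻ r (m , n , σ , τ , 1≤m , 1≤n , Pσ , Pτ , eq) with partition-word Pσ | partition-word Pτ
... | x , refl , rx , σ≡ | y , refl , ry , τ≡ =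
  x , y , blocks-injective r (RG-concat rx ry)
    (trans eq (trans (cong₂ (split (length x)) σ≡ τ≡) (split-blocks rx ry))) ,
  ≢[]-length 1≤m , ≢[]-length 1≤n , _ , ry

splitable⁺ : RG 0 w l → Splits w → Splitable (blocks 1 l w)
splitable⁺ {l = l} r (x , y , refl , x≢[] , y≢[] , e , ry) with RG-++⁻ x r
... | k , rx , _ = length x , length y , blocks 1 k x , blocks 1 e y , length-pos x≢[] , length-pos y≢[] ,
  blocks-partition rx , blocks-partition ry ,
  trans (cong (λ l → blocks 1 l (x ++ y)) (RG-functional r (RG-concat rx ry))) (sym (split-blocks rx ry))

slashable⁻ : RG 0 w l → IsProduct slash (blocks 1 l w) → Slashes w
slashable⁻ r (m , n , σ , τ , 1≤m , 1≤n , Pσ , Pτ , eq) with partition-word Pσ | partition-word Pτ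
... | x , refl , rx , σ≡ | y , refl , ry , τ≡ =
  subst Slashes
    (sym (blocks-injective r (RG-slash rx ry)
      (trans eq (trans (cong₂ (slash (length x)) σ≡ τ≡) (slash-blocks rx ry)))))
    (slashes⁺ rx (≢[]-length 1≤m) (≢[]-length 1≤n))

slashable⁺ : RG 0 w l → Slashes w → IsProduct slash (blocks 1 l w)
slashable⁺ r sl with slashes⁻ r sl
... | x , y , c , d , refl , x≢[] , y≢[] , rx , ry , refl =
  length x , length y , blocks 1 c x , blocks 1 d y , length-pos x≢[] , length-pos y≢[] ,
  blocks-partition rx , blocks-partition ry , sym (slash-blocks rx ry)

-- Restrictions

inInterval? : ∀ a b x → Dec (a ≤ x × x ≤ b)
inInterval? a b x = (a ≤? x) ×-dec (x ≤? b)

sort-sorted : ∀ {π} → AllPairs (_<_ on minElt) π → sort π ≡ π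
sort-sorted [] = refl
sort-sorted {B ∷ []}    ([] ∷ []) = refl
sort-sorted {B ∷ C ∷ π} ((B<C ∷ _) ∷ qs) 
  rewrite sort-sorted qs | dec-true (minElt B ≤? minElt C) (<⇒≤ B<C) = refl

filter-window : ∀ (G : ℕ → Block) a b n → (∀ {c} → c < a → G c ≡ []) → (∀ {c} → a + b ≤ c → G c ≡ []) →
                (∀ {c} → c < b → G (a + c) ≢ []) → a + b ≤ n →
                filter nonEmpty? (applyUpTo G n) ≡ applyUpTo (G ∘ (a +_)) b
filter-window G zero zero n _ above _ _ =
  filter-none nonEmpty? (All.applyUpTo⁺₂ G n λ c G≢[] → G≢[] (above z≤n))
filter-window G zero (suc b) (suc n) below above window (s≤s b≤n) =
  trans (filter-accept nonEmpty? (window (s≤s z≤n)))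
        (cong (G 0 ∷_) (filter-window (G ∘ suc) zero b n (λ ()) (above ∘ s≤s) (window ∘ s≤s) b≤n))
filter-window G (suc a) b (suc n) below above window (s≤s b≤n) =
  trans (filter-reject nonEmpty? λ G≢[] → G≢[] (below (s≤s z≤n)))
        (filter-window (G ∘ suc) a b n (below ∘ s≤s) (above ∘ s≤s) window b≤n)

-- The shift lets one computation serve prefixes and split factors (`a = 0`) as well as raised
-- factors. The surviving labels form the window from `a` to `a + b - 1`, and sorting changes
-- nothing because `y` is of restricted growth.
restrict-factor : ∀ x a {b n} y z → RG 0 y b → a + b ≤ n →
                  restrict (suc (length x)) (length x + length y) (blocks 1 n (x ++ map (a +_) y ++ z))
                    ≡ blocks (suc (length x)) b y
restrict-factor x a {b} {n} y z r a+b≤n = begin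
  sort (filter nonEmpty? (map keep (blocks 1 n (x ++ y′ ++ z))))
    ≡⟨ cong (sort ∘ filter nonEmpty?) (trans (map-applyUpTo _ keep n) (applyUpTo-cong n λ {c} _ → kept c)) ⟩
  sort (filter nonEmpty? (applyUpTo (λ c → positions p c y′) n))
    ≡⟨ cong sort (filter-window (λ c → positions p c y′) a b n below above window a+b≤n) ⟩
  sort (applyUpTo (λ c → positions p (a + c) y′) b)
    ≡⟨ cong sort (applyUpTo-cong b λ {c} _ → positions-relabel p a c y) ⟩
  sort (blocks p b y)
    ≡⟨ sort-sorted (AllPairs.applyUpTo⁺₁ _ b (positions-ordered p r z≤n)) ⟩
  blocks p b y ∎
  where
  open ≡-Reasoning
  p  = suc (length x)
  y′ = map (a +_) y
  |y′| = length-map (a +_) y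
  keep : Block → Block
  keep = filter (inInterval? p (length x + length y))
  kept : ∀ c → keep (positions 1 c (x ++ y′ ++ z)) ≡ positions p c y′
  kept c = begin
    keep (positions 1 c (x ++ y′ ++ z))
      ≡⟨ cong keep (trans (positions-++ 1 c x) (cong (positions 1 c x ++_) (positions-++ p c y′))) ⟩
    keep (positions 1 c x ++ positions p c y′ ++ positions (p + length y′) c z)
      ≡⟨ trans (filter-++ _ (positions 1 c x) _)
           (cong (keep (positions 1 c x) ++_) (filter-++ _ (positions p c y′) _)) ⟩
    keep (positions 1 c x) ++ keep (positions p c y′) ++ keep (positions (p + length y′) c z)
      ≡⟨ cong₂ _++_ (filter-none _ (All.map (λ (_ , q<p) (p≤q , _) → <⇒≱ q<p p≤q) (positions-range 1 c x)))
         (cong₂ _++_ (filter-all _ (All.map (map₂ λ q< → subst (λ n → _ ≤ length x + n) |y′| (≤-pred q<)) 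
           (positions-range p c y′)))
           (filter-none _ (All.map (λ (q≥ , _) (_ , q≤) → <⇒≱ (subst (λ n → p + n ≤ _) |y′| q≥) q≤)
             (positions-range (p + length y′) c z)))) ⟩
    positions p c y′ ++ []
      ≡⟨ ++-identityʳ _ ⟩
    positions p c y′ ∎
  y′<a+b : All (_< a + b) y′
  y′<a+b = All.map⁺ (All.map (+-monoʳ-< a) (RG-all< r))
  below : ∀ {c} → c < a → positions p c y′ ≡ []
  below c<a = positions-∉ p y′ λ c∈ → <⇒≱ c<a (All.lookup (≥-shift a y) c∈)
  above : ∀ {c} → a + b ≤ c → positions p c y′ ≡ []
  above a+b≤c = positions-∉ p y′ λ c∈ → <⇒≱ (All.lookup y′<a+b c∈) a+b≤c
  window : ∀ {c} → c < b → positions p (a + c) y′ ≢ []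
  window {c} c<b eq = positions-∈ p y (RG-surjective r z≤n c<b) (trans (sym (positions-relabel p a c y)) eq)

restrict-prefix : ∀ x {k n} z → RG 0 x k → k ≤ n →
                  restrict 1 (length x) (blocks 1 n (x ++ z)) ≡ blocks 1 k x
restrict-prefix x {n = n} z r k≤n = trans
  (cong (λ w → restrict 1 (length x) (blocks 1 n (w ++ z))) (sym (map-id x)))
  (restrict-factor [] 0 x z r k≤n)

restrict-suffix : ∀ x a {b n} y → RG 0 y b → a + b ≤ n →
                  restrict (suc (length x)) (length (x ++ map (a +_) y)) (blocks 1 n (x ++ map (a +_) y))
                    ≡ blocks (suc (length x)) b y
restrict-suffix x a {n = n} y r a+b≤n = trans
  (cong₂ (λ m w → restrict (suc (length x)) m (blocks 1 n (x ++ w)))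
    (trans (length-++ x) (cong (length x +_) (length-map (a +_) y))) (sym (++-identityʳ (map (a +_) y))))
  (restrict-factor x a y [] r a+b≤n)

restrict-suffix⁰ : ∀ x {b n} y → RG 0 y b → b ≤ n →
                   restrict (suc (length x)) (length (x ++ y)) (blocks 1 n (x ++ y))
                     ≡ blocks (suc (length x)) b y
restrict-suffix⁰ x {b} {n} y r b≤n = subst
  (λ w → restrict (suc (length x)) (length (x ++ w)) (blocks 1 n (x ++ w)) ≡ blocks (suc (length x)) b y)
  (map-id y) (restrict-suffix x 0 y r b≤n)

module _ (a b : ℕ) (π : Blocks) where
  private
    unsorted : Blocks
    unsorted = filter nonEmpty? (map (filter (inInterval? a b)) π)

  restrict-All : ∀ {P : Block → Set} → All P unsorted → All P (restrict a b π)
  restrict-All = All-resp-↭ (↭-sym (sort-↭ unsorted))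

  restrict-nonEmpty : All (_≢ []) (restrict a b π)
  restrict-nonEmpty = restrict-All (All.all-filter nonEmpty? (map (filter (inInterval? a b)) π))

  restrict-≥ : All (All (a ≤_)) (restrict a b π)
  restrict-≥ = restrict-All (All.filter⁺ nonEmpty? (All.map⁺
    (All.universal (λ B → All.map proj₁ (All.all-filter (inInterval? a b) B)) π)))

  restrict-sorted : AllPairs (_≤_ on minElt) (restrict a b π)
  restrict-sorted = Linked⇒AllPairs ≤-trans (sort-↗ unsorted)

-- The label word read off the blocks of the suffix is of restricted growth
-- because these blocks come sorted by their minima.
sorted-word : ∀ p y {π} → (∀ c → positions p c y ≡ blockAt π c) → All (_≢ []) π →
              AllPairs (_≤_ on minElt) π → RGF y
sorted-word p y {π} eq ne sorted with remaining-word (length y) {p} {0} {length π} {λ c → positions p c y} record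
  { increasing = λ c → positions-increasing p c y
  ; range      = ∈-positions-range p y
  ; cover      = λ p≤x x< → map₂ (λ (_ , x∈) → ∈-blockAt⇒< π (subst (_ ∈_) (eq _) x∈) , x∈) (positions-cover p y p≤x x<)
  ; disjoint   = positions-disjoint p y
  ; nonEmpty   = λ _ → nonEmpty
  ; ordered    = λ _ → ordered
  ; k≤l        = z≤n
  }
  where
  nonEmpty : ∀ {c} → c < length π → positions p c y ≢ []
  nonEmpty c<l = subst (_≢ []) (sym (eq _)) (blockAt-All ne c<l)
  ordered : ∀ {c d} → c < d → d < length π → minElt (positions p c y) < minElt (positions p d y)
  ordered {c} {d} c<d d<l = ≤∧≢⇒<
    (subst₂ (λ B C → minElt B ≤ minElt C) (sym (eq c)) (sym (eq d)) (blockAt-AllPairs sorted c<d d<l))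
    λ same-min → <⇒≢ c<d (positions-disjoint p y (minElt-∈ (nonEmpty (<-trans c<d d<l)))
      (subst (_∈ _) (sym same-min) (minElt-∈ (nonEmpty d<l))))
... | y′ , _ , r , eq′ = length π , subst (λ y → RG 0 y _) (sym (positions-injective p y y′ eq′)) r

firstBlock-⊆ : ∀ π {x} → x ∈ firstBlock π → x ∈ concat π
firstBlock-⊆ (_ ∷ _) = ∈-++⁺ˡ

-- Block `c` of the word is its part in the prefix followed by its part in the suffix; by the
-- splitting equation it is also the former followed by block `c` of the sorted restriction.
-- Cancelling shows that the suffix labels its blocks in order of minima, so `sorted-word` applies.
splitsAt⁻ : ∀ {i} → RG 0 w l → SplitsAt (length w) (blocks 1 l w) i →
            ∃₂ λ x y → w ≡ x ++ y × length x ≡ i ∸ 1 × RGF y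
splitsAt⁻ {w} {l} {suc m} r (i∈ , s≤s 1≤m , eq) 
  with RG-++⁻ (take m w) (subst (λ w → RG 0 w l) (sym (take++drop≡id m w)) r)
... | k , rx , ry = w₁ , w₂ , sym w≡ , |w₁| , sorted-word (suc m) w₂ suffix-blocks
    (restrict-nonEmpty (suc m) (length w) (blocks 1 l w)) (restrict-sorted (suc m) (length w) (blocks 1 l w))
  where
  open ≡-Reasoning
  w₁ = take m w
  w₂ = drop m w
  Z = restrict (suc m) (length w) (blocks 1 l w)
  w≡ : w₁ ++ w₂ ≡ w
  w≡ = take++drop≡id m w
  -- Membership of `i` in the first block bounds it by the size of the partition, so the prefix
  -- really has length `m`.
  m<n : m < length w
  m<n = ≤-pred (proj₂ (∈-blocks⁻ 1 {l} w (firstBlock-⊆ (blocks 1 l w) i∈)))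
  |w₁| : length w₁ ≡ m
  |w₁| = trans (length-take m w) (m≤n⇒m⊓n≡m (<⇒≤ m<n))
  prefix : restrict 1 m (blocks 1 l w) ≡ blocks 1 k w₁
  prefix = subst₂ (λ m w → restrict 1 m (blocks 1 l w) ≡ blocks 1 k w₁) |w₁| w≡
    (restrict-prefix w₁ w₂ rx (RG-mono ry))
  union : blocks 1 l w ≡ unionBlocks (blocks 1 k w₁) Z
  union = trans eq (cong₂ unionBlocks prefix
    (⊟-⊞ (All.map (All.map <⇒≤) (restrict-≥ (suc m) (length w) (blocks 1 l w)))))
  suffix-blocks : ∀ c → positions (suc m) c w₂ ≡ blockAt Z c
  suffix-blocks c = ++-cancelˡ (positions 1 c w₁) _ _ (begin
    positions 1 c w₁ ++ positions (suc m) c w₂          ≡⟨ cong (λ q → positions 1 c w₁ ++ positions (suc q) c w₂) |w₁| ⟨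
    positions 1 c w₁ ++ positions (suc (length w₁)) c w₂ ≡⟨ positions-++ 1 c w₁ ⟨
    positions 1 c (w₁ ++ w₂)                            ≡⟨ cong (positions 1 c) w≡ ⟩
    positions 1 c w                                   ≡⟨ blockAt-blocks 1 r c ⟨
    blockAt (blocks 1 l w) c                          ≡⟨ cong (λ π → blockAt π c) union ⟩
    blockAt (unionBlocks (blocks 1 k w₁) Z) c          ≡⟨ blockAt-unionBlocks (blocks 1 k w₁) Z c ⟩
    blockAt (blocks 1 k w₁) c ++ blockAt Z c           ≡⟨ cong (_++ blockAt Z c) (blockAt-blocks 1 rx c) ⟩
    positions 1 c w₁ ++ blockAt Z c                    ∎)

splitsAt-least : ∀ u v {i} → ¬ Splits u → RG 0 (u ++ v) l →
                 SplitsAt (length (u ++ v)) (blocks 1 l (u ++ v)) i → suc (length u) ≤ i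
splitsAt-least u v {suc m} unsp r sp with splitsAt⁻ r sp
... | x , y , eq , refl , ry with unsplit-first u unsp (≢[]-length (≤-pred (proj₁ (proj₂ sp)))) ry eq
... | t , refl , _ = s≤s (subst (length u ≤_) (sym (length-++ u)) (m≤m+n _ _))

splitsAt⁺ : ∀ x y {k e} → RG 0 x k → RG 0 y e → x ≢ [] → y ≢ [] →
            SplitsAt (length (x ++ y)) (blocks 1 (k ⊔ e) (x ++ y)) (suc (length x))
splitsAt⁺ x y {k} {e} rx ry x≢[] y≢[] = first , s≤s (length-pos x≢[]) , sym (begin
  split (length x) (restrict 1 (length x) π) (restrict (suc (length x)) (length (x ++ y)) π ⊟ length x)
    ≡⟨ cong₂ (λ σ τ → split (length x) σ (τ ⊟ length x))
         (restrict-prefix x y rx (m≤m⊔n k e)) (restrict-suffix⁰ x y ry (m≤n⊔m k e)) ⟩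
  split (length x) (blocks 1 k x) (blocks (suc (length x)) e y ⊟ length x)
    ≡⟨ cong (split (length x) (blocks 1 k x)) (blocks-⊟ 1 e y (length x)) ⟩
  split (length x) (blocks 1 k x) (blocks 1 e y)
    ≡⟨ split-blocks rx ry ⟩
  π ∎)
  where
  open ≡-Reasoning
  π = blocks 1 (k ⊔ e) (x ++ y)
  firstBlock-blocks : ∀ {l} w → 1 ≤ l → firstBlock (blocks 1 l w) ≡ positions 1 0 w
  firstBlock-blocks w (s≤s _) = refl
  starts : ∀ p {y e} → RG 0 y e → y ≢ [] → p ∈ positions p 0 y
  starts p []           y≢[] = contradiction refl y≢[]
  starts p (new refl _) _    = here refl
  -- A nonempty restricted growth word starts with 0, so the first position of `y` lies in the block
  -- of 1.
  first : suc (length x) ∈ firstBlock π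
  first = subst (suc (length x) ∈_)
    (sym (trans (firstBlock-blocks (x ++ y) (≤-trans (RG-nonEmpty rx x≢[]) (m≤m⊔n k e))) (positions-++ 1 0 x)))
    (∈-++⁺ʳ (positions 1 0 x) (starts _ ry y≢[]))

-- The map φ

module Factors (T : Triple) where
  open Triple T

  sourceBlocks targetBlocks : Blocks
  sourceBlocks = blocks 1 (h ⊔ (a + b)) source
  targetBlocks = blocks 1 (h + b) target

  private
    i = suc (length u)
    j = suc (length s)
    π = blocks i (a + b) v

    j≡ : j ≡ i + length v₁
    j≡ = cong suc (length-++ u)

    i≤j : i ≤ j
    i≤j = subst (i ≤_) (sym j≡) (m≤m+n i _)

    end : j + length v₂ ≡ i + length v
    end = begin
      j + length v₂                                ≡⟨ cong₂ _+_ j≡ (sym (length-map (a +_) v₂)) ⟩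
      i + length v₁ + length (map (a +_) v₂)       ≡⟨ +-assoc i _ _ ⟩
      i + (length v₁ + length (map (a +_) v₂))     ≡⟨ cong (i +_) (length-++ v₁) ⟨
      i + length v                                 ∎
      where open ≡-Reasoning

    restrict-i : restrict i (length source) sourceBlocks ≡ π
    restrict-i = restrict-suffix⁰ u v rv (m≤n⊔m h (a + b))

    source≡ : s ++ map (a +_) v₂ ≡ source
    source≡ = ++-assoc u v₁ _

    restrict-j : restrict j (length source) sourceBlocks ≡ blocks j b v₂
    restrict-j = subst (λ w → restrict j (length w) (blocks 1 (h ⊔ (a + b)) w) ≡ blocks j b v₂) source≡
      (restrict-suffix s a v₂ rv₂ (m≤n⊔m h (a + b)))

    restrict-s : restrict 1 (length s) sourceBlocks ≡ blocks 1 h s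
    restrict-s = subst (λ w → restrict 1 (length s) (blocks 1 (h ⊔ (a + b)) w) ≡ blocks 1 h s) source≡
      (restrict-prefix s _ rs (m≤m⊔n h (a + b)))

    i-least : IsLeast (SplitsAt (length source) sourceBlocks) i
    i-least = splitsAt⁺ u v ru rv u≢[] v≢[] , λ _ → splitsAt-least u v unsplit source-RG

    drop-π : drop a π ≡ blocks j b v₂
    drop-π = trans (drop-applyUpTo _ a b) (applyUpTo-cong b λ {c} _ → begin
      positions i (a + c) v
        ≡⟨ positions-++ i (a + c) v₁ ⟩
      positions i (a + c) v₁ ++ positions (i + length v₁) (a + c) (map (a +_) v₂)
        ≡⟨ cong₂ _++_ (positions-∉ i v₁ λ c∈ → <⇒≱ (All.lookup (RG-all< rv₁) c∈) (m≤m+n a c))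
             (positions-relabel _ a c v₂) ⟩
      positions (i + length v₁) c v₂
        ≡⟨ cong (λ p → positions p c v₂) j≡ ⟨
      positions j c v₂ ∎)
      where open ≡-Reasoning

    j-least : IsLeast (_∈ concat (blocks j b v₂)) j
    j-least = ∈-blocks⁺ j rv₂ ≤-refl (m<m+n j (length-pos v₂≢[])) , λ _ → proj₁ ∘ ∈-blocks⁻ j {b} v₂

    upper : IsUpperFrom π a
    upper = subst (a <_) (sym (length-applyUpTo _ (a + b))) (m<m+n a (RG-nonEmpty rv₂ v₂≢[])) ,
      j , ∈-blocks⁺ i rv i≤j (subst (j <_) end (m<m+n j (length-pos v₂≢[]))) ,
      λ x → subst (λ ρ → x ∈ concat ρ ⇔ (x ∈ concat π × j ≤ x)) (sym drop-π) (mk⇔ to from)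
      where
      to : ∀ {x} → x ∈ concat (blocks j b v₂) → x ∈ concat π × j ≤ x
      to x∈ with ∈-blocks⁻ j {b} v₂ x∈
      ... | j≤x , x< = ∈-blocks⁺ i rv (≤-trans i≤j j≤x) (<-≤-trans x< (≤-reflexive end)) , j≤x
      from : ∀ {x} → x ∈ concat π × j ≤ x → x ∈ concat (blocks j b v₂)
      from (x∈ , j≤x) = ∈-blocks⁺ j rv₂ j≤x (<-≤-trans (proj₂ (∈-blocks⁻ i {a + b} v x∈)) (≤-reflexive (sym end)))

    -- An upper union of blocks starting at t cuts v at t into a slash product.
    greatest : ∀ r → IsUpperFrom π r → r ≤ a
    greatest r (r<l , t , t∈ , union) with ∈-blocks⁻ i {a + b} v t∈
    ... | i≤t , t< with m≤n⇒∃[o]m+o≡n i≤t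
    ... | q , refl with RG-++⁻ (take q v) (subst (λ w → RG 0 w (a + b)) (sym (take++drop≡id q v)) rv)
    ... | c , rx , ry = slash-count x++y≡v y≢[] (subst (RG 0 (take q v)) c≡r rx) r≤y
      where
      x++y≡v : take q v ++ drop q v ≡ v
      x++y≡v = take++drop≡id q v
      q<v : q < length v
      q<v = +-cancelˡ-< i _ _ t<
      |x| : length (take q v) ≡ q
      |x| = trans (length-take q v) (m≤n⇒m⊓n≡m (<⇒≤ q<v))
      y≢[] : drop q v ≢ []
      y≢[] = ≢[]-length (subst (1 ≤_) (sym (length-drop q v)) (m<n⇒0<n∸m q<v))
      r<e : r < a + b
      r<e = subst (r <_) (length-applyUpTo _ (a + b)) r<l
      split-positions : ∀ d → positions i d v ≡ positions i d (take q v) ++ positions (i + q) d (drop q v)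
      split-positions d = trans (cong (positions i d) (sym x++y≡v))
        (trans (positions-++ i d (take q v))
          (cong (λ n → positions i d (take q v) ++ positions (i + n) d (drop q v)) |x|))
      label-≥ : ∀ {d X} → X ∈ concat (drop r π) → X ∈ positions i d v → r ≤ d
      label-≥ {d} {X} X∈ X∈d with m≤n⇒∃[o]m+o≡n (<⇒≤ r<e)
      ... | f , r+f≡e with ∈-concat-applyUpTo⁻ (λ c → positions i (r + c) v) {f}
        (subst (λ ρ → X ∈ concat ρ) (trans (cong (λ n → drop r (blocks i n v)) (sym r+f≡e)) (drop-applyUpTo _ r f)) X∈)
      ... | g , _ , X∈g = subst (r ≤_) (positions-disjoint i v X∈g X∈d) (m≤m+n r g)
      ∈-upper : ∀ {d X} → r ≤ d → d < a + b → X ∈ positions i d v → X ∈ concat (drop r π)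
      ∈-upper {d} {X} r≤d d<e X∈d with m≤n⇒∃[o]m+o≡n r≤d | m≤n⇒∃[o]m+o≡n (<⇒≤ r<e)
      ... | g , refl | f , r+f≡e = subst (λ ρ → X ∈ concat ρ)
        (sym (trans (cong (λ n → drop r (blocks i n v)) (sym r+f≡e)) (drop-applyUpTo _ r f)))
        (∈-concat-applyUpTo⁺ (λ c → positions i (r + c) v)
          (+-cancelˡ-< r _ _ (subst (r + g <_) (sym r+f≡e) d<e)) X∈d)
      -- A letter after the cut marks an element that is at least `t`, so its block is among those
      -- kept by `drop r`.
      r≤y : All (r ≤_) (drop q v)
      r≤y = All.tabulate λ {d} d∈y →
        let X   = minElt (positions (i + q) d (drop q v))
            X∈y = minElt-∈ (positions-∈ (i + q) (drop q v) d∈y)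
            X∈v = subst (X ∈_) (sym (split-positions d)) (∈-++⁺ʳ (positions i d (take q v)) X∈y)
            X≥  = proj₁ (∈-positions-range (i + q) (drop q v) X∈y)
        in label-≥ (Equivalence.from (union _)
             (∈-blocks⁺ i rv (≤-trans i≤t X≥) (proj₂ (∈-positions-range i v X∈v)) , X≥)) X∈v
      -- Block `r` is kept, so all its elements are at least `t`, whereas the prefix marks elements
      -- below `t`.
      r∉x : r ∉ take q v
      r∉x r∈x =
        let X   = minElt (positions i r (take q v))
            X∈x = minElt-∈ (positions-∈ i (take q v) r∈x)
            X∈v = subst (X ∈_) (sym (split-positions r)) (∈-++⁺ˡ X∈x)
        in <⇒≱ (subst (λ n → X < i + n) |x| (proj₂ (∈-positions-range i (take q v) X∈x)))
               (proj₂ (Equivalence.to (union _) (∈-upper ≤-refl r<e X∈v)))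
      r≤c : ∀ {y e} → RG c y e → All (r ≤_) y → y ≢ [] → r ≤ c
      r≤c _ []        y≢[] = contradiction refl y≢[]
      r≤c r (r≤d ∷ _) _    = ≤-trans r≤d (RG-head r)
      -- More than `r` labels in the prefix would include `r`; fewer would forbid the next letter,
      -- which is at least `r`.
      c≡r : c ≡ r
      c≡r = ≤-antisym (≮⇒≥ λ r<c → r∉x (RG-surjective rx z≤n r<c)) (r≤c ry r≤y y≢[])

  isφ : Isφ (length source) sourceBlocks targetBlocks
  isφ = record
    { i       = i
    ; i-least = i-least
    ; ρ       = blocks j b v₂
    ; ρ-isR   = subst (λ σ → IsR σ (blocks j b v₂)) (sym restrict-i) (a , (upper , greatest) , sym drop-π)
    ; j       = j
    ; j-least = j-least
    -- Restriction undoes the raising of `v₂` by `a`, and the slash product raises it again by `h`,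
    -- the block count of `s`.
    ; value   = sym (trans
        (cong₂ (slash (length s)) restrict-s (trans (cong (_⊟ length s) restrict-j) (blocks-⊟ 1 b v₂ (length s))))
        (slash-blocks rs rv₂))
    }

-- The bijection

open Triple using (source; target)
open Factors using (sourceBlocks; targetBlocks)

source-∈ : ∀ T → (𝒜 (length (source T)) ∖ 𝒰𝒮 (length (source T))) (sourceBlocks T)
source-∈ T = (blocks-partition source-RG , source-atomic ∘ slashable⁻ source-RG) ,
             λ (_ , unsp) → unsp (splitable⁺ source-RG source-splits)
  where open Triple T hiding (source)

target-∈ : ∀ T → (𝒰𝒮 (length (source T)) ∖ 𝒜 (length (source T))) (targetBlocks T)
target-∈ T = (subst (λ n → PartitionOf[ n ] (targetBlocks T)) (sym length-source≡target) (blocks-partition target-RG) ,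
              target-unsplit ∘ splitable⁻ target-RG) ,
             λ (_ , atom) → atom (slashable⁺ target-RG target-slashes)
  where open Triple T hiding (source; target)

source-factors : ∀ {n π} → (𝒜 n ∖ 𝒰𝒮 n) π → ∃ λ T → length (source T) ≡ n × π ≡ sourceBlocks T
source-factors {n} {π} ((P , atom) , ¬unsplit) with partition-word P
... | w , refl , r , eq with splits? w
... | no unsp = contradiction (P , λ sp → unsp (splitable⁻ r (subst Splitable eq sp))) ¬unsplit
... | yes sp with factorSource r (λ sl → atom (subst (IsProduct slash) (sym eq) (slashable⁺ r sl))) sp
... | T , refl = T , refl , trans eq (cong (λ l → blocks 1 l (source T)) (RG-functional r (Triple.source-RG T)))

target-factors : ∀ {n π} → (𝒰𝒮 n ∖ 𝒜 n) π → ∃ λ T → length (source T) ≡ n × π ≡ targetBlocks T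
target-factors {n} {π} ((P , unsp) , ¬atomic) with partition-word P
... | w , refl , r , eq with slashes? w
... | no atom = contradiction (P , λ sl → atom (slashable⁻ r (subst (IsProduct slash) eq sl))) ¬atomic
... | yes sl with factorTarget r (λ sp → unsp (subst Splitable (sym eq) (splitable⁺ r sp))) sl
... | T , refl = T , Triple.length-source≡target T ,
  trans eq (cong (λ l → blocks 1 l (target T)) (RG-functional r (Triple.target-RG T)))

-- Independence of the chosen triple. Surjectivity needs it, because the triple found for a source
-- need not be the one from which that source was built.
sourceBlocks≡⇒targetBlocks≡ : ∀ T T′ → sourceBlocks T ≡ sourceBlocks T′ → targetBlocks T ≡ targetBlocks T′
sourceBlocks≡⇒targetBlocks≡ T T′ eq = blocks-cong T.target-RG T′.target-RG
  (target-cong T T′ (source-injective T T′ (blocks-injective T.source-RG T′.source-RG eq)))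
  where module T = Triple T; module T′ = Triple T′

targetBlocks≡⇒sourceBlocks≡ : ∀ T T′ → targetBlocks T ≡ targetBlocks T′ → sourceBlocks T ≡ sourceBlocks T′
targetBlocks≡⇒sourceBlocks≡ T T′ eq = blocks-cong T.source-RG T′.source-RG
  (source-cong T T′ (target-injective T T′ (blocks-injective T.target-RG T′.target-RG eq)))
  where module T = Triple T; module T′ = Triple T′

mainTheorem1 : (n : ℕ) → 1 ≤ n →
    Σ (⟦ 𝒜 n ∖ 𝒰𝒮 n ⟧ → ⟦ 𝒰𝒮 n ∖ 𝒜 n ⟧) λ φ →
    (∀ π → Isφ n (proj₁ π) (proj₁ (φ π))) ×
    Bijective (_≈_ {𝒜 n ∖ 𝒰𝒮 n}) (_≈_ {𝒰𝒮 n ∖ 𝒜 n}) φ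
mainTheorem1 n _ = φ , graph , (λ {π} {π′} → injective {π} {π′}) , surjective
  where
  factors : (π : ⟦ 𝒜 n ∖ 𝒰𝒮 n ⟧) → ∃ λ T → length (source T) ≡ n × proj₁ π ≡ sourceBlocks T
  factors (π , π∈) = source-factors {n} {π} π∈

  φ : ⟦ 𝒜 n ∖ 𝒰𝒮 n ⟧ → ⟦ 𝒰𝒮 n ∖ 𝒜 n ⟧
  φ π with factors π
  ... | T , refl , _ = targetBlocks T , target-∈ T

  φ-value : ∀ π → proj₁ (φ π) ≡ targetBlocks (proj₁ (factors π))
  φ-value π with factors π
  ... | T , refl , _ = refl

  graph : ∀ π → Isφ n (proj₁ π) (proj₁ (φ π))
  graph π with factors π
  ... | T , refl , eq = subst (λ σ → Isφ _ σ (targetBlocks T)) (sym eq) (Factors.isφ T)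

  injective : ∀ {π π′} → proj₁ (φ π) ≡ proj₁ (φ π′) → proj₁ π ≡ proj₁ π′
  injective {π} {π′} eq = trans (proj₂ (proj₂ (factors π))) (trans
    (targetBlocks≡⇒sourceBlocks≡ (proj₁ (factors π)) (proj₁ (factors π′)) (trans (sym (φ-value π)) (trans eq (φ-value π′))))
    (sym (proj₂ (proj₂ (factors π′)))))

  surjective : ∀ ρ → ∃ λ π → ∀ {σ} → proj₁ σ ≡ proj₁ π → proj₁ (φ σ) ≡ proj₁ ρ
  surjective (ρ , ρ∈) with target-factors {n} {ρ} ρ∈
  ... | T , refl , refl = (sourceBlocks T , source-∈ T) , λ {σ} eq → trans (φ-value σ)
    (sourceBlocks≡⇒targetBlocks≡ (proj₁ (factors σ)) T (trans (sym (proj₂ (proj₂ (factors σ)))) eq))
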